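{- Let $\lambda$ be a partition of $n$ that is neither hook-shaped nor self-transpose, and let $N=|\mathrm{SYT}(\lambda)|$. Then the image of the cactus group $C_n$ in the permutation group $S_N$ of the set $\mathrm{SYT}(\lambda)$ is either all of $S_N$ or the alternating group $A_N$.
   Context: A partition $\lambda$ of $n$ is identified with its Young diagram (boxes $(i,j)$, row $i$, column $j$). A standard Young tableau of shape $\lambda$ is a filling of the boxes by $1,\dots,n$, each used once, increasing along rows and down columns; $\mathrm{SYT}(\lambda)$ is the set of these. $\lambda$ is hook-shaped if its diagram does not contain the box $(2,2)$, and self-transpose if it equals its transpose. The cactus group $C_n$ is generated by $s_{[i,j]}$ ($1\le i<j\le n$) with relations $s_{[i,j]}^2=1$; $s_{[i,j]}s_{[k,l]}=s_{[k,l]}s_{[i,j]}$ if $[i,j]\cap[k,l]=\emptyset$; $s_{[i,j]}s_{[k,l]}s_{[i,j]}=s_{[i+j-l,i+j-k]}$ if $[k,l]\subseteq[i,j]$. It acts on $\mathrm{SYT}(\lambda)$ with $s_{[1,j]}$ acting as the Schützenberger involution (evacuation) of the subtableau of entries $1,\dots,j$; the image of $C_n$ in the permutations of $\mathrm{SYT}(\lambda)$ equals the group generated by the Bender–Knuth involutions $t_1,\dots,t_{n-1}$ ($t_i$ swaps $i$ and $i+1$ if the result is standard, and is the identity otherwise). -}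

module Defs where

open import Data.Nat using (ℕ; zero; suc; _≤_; _<_; _≥_; _≡ᵇ_; _<ᵇ_)
import Data.Nat.Properties as ℕP
open import Data.Nat.Divisibility using (_∣_)
open import Data.Bool using (Bool; true; false; _∧_; if_then_else_)
open import Data.List using (List; []; _∷_; map; length; concat; upTo)
open import Data.Nat.ListAction using (sum)
import Data.List.Properties as LP
open import Data.List.Relation.Unary.All using (All)
open import Data.List.Relation.Unary.Linked using (Linked)
open import Data.Product using (Σ; ∃; _×_; _,_; proj₁)
open import Relation.Nullary using (¬_; Dec; yes; no)
open import Relation.Nullary.Decidable using (⌊_⌋)
open import Relation.Binary.PropositionalEquality using (_≡_; _≢_)
open import Function using (_∘_; id)
open import Function.Bundles using (_⇔_)

-- Partitions and Young diagrams (rows/columns indexed from 0 here: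
-- the paper's box (i,j) is our box (i-1, j-1)).

IsPartition : ℕ → List ℕ → Set
IsPartition n μ = Linked _≥_ μ × All (0 <_) μ × sum μ ≡ n

rowLen : List ℕ → ℕ → ℕ
rowLen []       _       = 0
rowLen (x ∷ _)  zero    = x
rowLen (_ ∷ xs) (suc i) = rowLen xs i

InDiagram : List ℕ → ℕ → ℕ → Set
InDiagram μ i j = j < rowLen μ i

-- hook-shaped: the diagram does not contain the box (2,2) (0-indexed (1,1))
HookShaped : List ℕ → Set
HookShaped μ = ¬ InDiagram μ 1 1

SelfTranspose : List ℕ → Set
SelfTranspose μ = ∀ i j → InDiagram μ i j ⇔ InDiagram μ j i

-- Tableaux: a tableau is given by its list of rows.

Tableau : Set
Tableau = List (List ℕ)

incr : List ℕ → Bool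
incr []           = true
incr (a ∷ [])     = true
incr (a ∷ b ∷ xs) = (a <ᵇ b) ∧ incr (b ∷ xs)

below : List ℕ → List ℕ → Bool
below _        []       = true
below []       (_ ∷ _)  = false
below (a ∷ as) (b ∷ bs) = (a <ᵇ b) ∧ below as bs

colsIncr : Tableau → Bool
colsIncr []           = true
colsIncr (r ∷ [])     = true
colsIncr (r ∷ s ∷ rs) = below r s ∧ colsIncr (s ∷ rs)

allB : {A : Set} → (A → Bool) → List A → Bool
allB p []       = true
allB p (x ∷ xs) = p x ∧ allB p xs

occ : ℕ → List ℕ → ℕ
occ k []       = 0
occ k (x ∷ xs) = if x ≡ᵇ k then suc (occ k xs) else occ k xs

entriesOK : ℕ → Tableau → Bool
entriesOK n T =
  (length (concat T) ≡ᵇ n) ∧ allB (λ k → occ (suc k) (concat T) ≡ᵇ 1) (upTo n)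

isSYT : ℕ → List ℕ → Tableau → Bool
isSYT n μ T =
  ⌊ LP.≡-dec ℕP._≟_ (map length T) μ ⌋ ∧ entriesOK n T ∧ allB incr T ∧ colsIncr T

SYT : ℕ → List ℕ → Set
SYT n μ = Σ Tableau (λ T → isSYT n μ T ≡ true)

swapVal : ℕ → ℕ → ℕ
swapVal i x = if x ≡ᵇ i then suc i else (if x ≡ᵇ suc i then i else x)

swapT : ℕ → Tableau → Tableau
swapT i T = map (map (swapVal i)) T

bk : (n : ℕ) (μ : List ℕ) → ℕ → SYT n μ → SYT n μ
bk n μ i (T , p) with isSYT n μ (swapT i T) in eq
... | true  = swapT i T , eq
... | false = T , p

evalWord : (n : ℕ) (μ : List ℕ) → List ℕ → SYT n μ → SYT n μ
evalWord n μ []      x = x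
evalWord n μ (i ∷ w) x = bk n μ i (evalWord n μ w x)

-- f lies in the image of the cactus group C_n in Sym(SYT(μ)),
-- i.e. in the group generated by t_1,…,t_{n-1} (words in involutions)
InImage : (n : ℕ) (μ : List ℕ) → (SYT n μ → SYT n μ) → Set
InImage n μ f =
  Σ (List ℕ) λ w → All (λ i → 1 ≤ i × i < n) w × (∀ x → f x ≡ evalWord n μ w x)

Bijective : {X : Set} → (X → X) → Set
Bijective {X} f = (∀ x y → f x ≡ f y → x ≡ y) × (∀ y → ∃ λ x → f x ≡ y)

IsTransposition : {X : Set} → (X → X) → Set
IsTransposition {X} τ =
  Σ X λ x → Σ X λ y → x ≢ y × τ x ≡ y × τ y ≡ x × (∀ z → z ≢ x → z ≢ y → τ z ≡ z)

compose : {X : Set} → List (X → X) → X → X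
compose []       = id
compose (τ ∷ τs) = τ ∘ compose τs

EvenPerm : {X : Set} → (X → X) → Set
EvenPerm {X} f =
  Σ (List (X → X)) λ τs → All IsTransposition τs × 2 ∣ length τs × (∀ x → f x ≡ compose τs x)

{-# OPTIONS --safe #-}
module Submission where

-- A standard tableau is a path in Young's lattice, and tᵢ changes the path in one place.
-- Let K be the group generated by t₁, …, tₙ₋₁, acting on the tableaux of all shapes with n boxes
-- at once and commuting with transposition.  By induction on n, for every shape λ containing the
-- box (2,2), which is (1 , 1) below, all 3-cycles of tableaux of shape λ modulo transposition lie
-- in K, with trivial action on all shapes other than λ and its transpose.
-- For the step, let c ≠ d be corners of λ other than (2,2).  A 3-cycle of the shape λ − c and the
-- conjugate by tₙ of a 3-cycle of the shape λ − d can be chosen so that their supports meet in one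
-- tableau of shape λ and in no other shape; their commutator is then a 3-cycle.  Rectangles and
-- the shapes (k,2) have only one such corner, and there c = d and the common tableau is fixed by tₙ.
-- The relation "equal or in a common 3-cycle" is a K-invariant equivalence, and the 3-cycles of the
-- shapes λ − c together with tₙ show that it has one class.  Shapes with 5, 6 and 7 boxes are checked
-- by computation.  If λ is not self-transpose, K thus contains all 3-cycles on SYT(λ), hence the
-- alternating group, and it is the symmetric group exactly if some tᵢ is odd.

open import Data.Nat using (ℕ; zero; suc; _+_; _≤_; _<_; z≤n; s≤s; _≟_; _≤?_; _<?_; _≡ᵇ_; _<ᵇ_)
open import Data.Nat.Properties using (suc-injective; ≤-refl; ≤-trans; ≤-reflexive; n<1+n; m<n⇒m<1+n; ≤-antisym; <⇒≢; ≤∧≢⇒<; n≤1+n; ≰⇒>; 1+n≰n; ≤-pred; ≤-total; ≡ᵇ⇒≡; ≡⇒≡ᵇ; <ᵇ⇒<; <⇒<ᵇ; <-trans; m≤m+n; m≤n+m; +-mono-≤; <⇒≤; n≮n; +-suc)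
open import Data.Product using (Σ; ∃; ∃₂; _×_; _,_; proj₁; proj₂; swap)
open import Data.Product.Properties using () renaming (≡-dec to ×-≡-dec)
open import Data.Sum using (_⊎_; inj₁; inj₂; [_,_]′)
open import Data.Empty using (⊥; ⊥-elim)
open import Data.List using (List; []; _∷_; _++_; map; length; reverse; _∷ʳ_; upTo; cartesianProduct; concatMap; filter; concat)
open import Data.List.Properties using (length-map; unfold-reverse; ∷-injectiveˡ; ∷-injectiveʳ; length-++; concat-map; length-upTo) renaming (≡-dec to List-≡-dec)
open import Data.List.Membership.Propositional using (_∈_; _∉_; find; lose)
open import Data.List.Membership.Propositional.Properties using (∈-map⁺; ∈-map⁻; ∈-∃++; ∈-cartesianProduct⁺; ∈-upTo⁺; ∈-++⁺ˡ; ∈-++⁺ʳ; ∈-concatMap⁺; ∈-filter⁺; ∈-concat⁻′; ∈-concat⁺′; ∈-upTo⁻)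
open import Data.List.Relation.Unary.Any using (here; there; any?; Any)
open import Data.List.Relation.Unary.All using (All; []; _∷_; all?)
import Data.List.Relation.Unary.All as All
import Data.List.Relation.Unary.All.Properties as AllP
open import Data.List.Relation.Binary.Permutation.Propositional using (_↭_; ↭-refl; ↭-sym; ↭-trans; ↭-prep; ↭-swap)
open import Data.List.Relation.Binary.Permutation.Propositional.Properties using (∈-resp-↭; All-resp-↭; map⁺; ↭-reverse; drop-∷; ↭-length; shift)
open import Data.List.Relation.Binary.Subset.Propositional using (_⊆_)
open import Relation.Nullary using (¬_; Dec; yes; no; contradiction; does; _because_; proof)
open import Relation.Nullary.Decidable using (_⊎-dec_; _×-dec_; ¬?; _→-dec_; ⌊_⌋)
open import Relation.Binary.PropositionalEquality using (_≡_; _≢_; refl; sym; trans; cong; cong₂; subst; subst₂; module ≡-Reasoning)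
open import Relation.Binary.Definitions using (DecidableEquality)
open import Function using (_∘_; id; case_of_)
open import Data.Fin using (Fin)
open import Data.List.Relation.Unary.Unique.Propositional using (Unique)
open import Data.List.Relation.Unary.AllPairs using ([]; _∷_)
open import Data.Fin.Patterns using (0F; 1F; 2F; 3F; 4F)
open import Data.Fin.Properties using () renaming (_≟_ to _≟ᶠ_; all? to allFin?)
open import Relation.Unary using (Decidable)
open import Data.Bool using (Bool; true; false; _∧_)
open import Defs
open import Data.Nat.Divisibility using (_∣_; _∣0; ∣m+n∣m⇒∣n; ∣-refl; ∣m∣n⇒∣m+n; ∣1⇒≡1)
open import Data.Bool.Properties using (T-≡) renaming (_≟_ to _≟ᵇ_)
open import Function.Bundles using (Equivalence; _⇔_; mk⇔)
open import Axiom.UniquenessOfIdentityProofs using (module Decidable⇒UIP)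
import Data.List.Relation.Unary.Unique.Propositional.Properties as UniqueP

-- Tableaux as paths in Young's lattice

-- Every word commutes with `flip`, so whatever it does on one shape it repeats on the transposed
-- one; cycles of classes modulo `flip` are the finest that can be isolated. The difficulty appears
-- when a box is put back. If λ - c is self-transpose and c is off the diagonal, then `c ∷ y` and
-- `c ∷ flip y` are different classes of λ over one class of λ - c, and a cycle below does not
-- determine what happens to them. Such a corner is called bad. A shape has at most one
-- (`bad-unique`), and a further corner, or one uncovered by removing a good corner, makes up for
-- it. The seven-box shapes (3,2,2) and (4,2,1) have a bad corner but no such substitute other than
-- (1 , 1), so the induction starts at eight boxes. For the same reason a cycle has to fix all other
-- tableaux exactly: a word that transposed some of them would move tableaux with one more box.

Box : Set
Box = ℕ × ℕ

-- The standard tableau with k in box bₖ is the list bₙ ∷ … ∷ b₁ ∷ [].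
Path : Set
Path = List Box

_≟ᴮ_ : DecidableEquality Box
_≟ᴮ_ = ×-≡-dec _≟_ _≟_

_≟ᴾ_ : DecidableEquality Path
_≟ᴾ_ = List-≡-dec _≟ᴮ_

right down : Box → Box
right (i , j) = i , suc j
down  (i , j) = suc i , j

infix 4 _⋖_

_⋖_ : Box → Box → Set
c ⋖ b = b ≡ right c ⊎ b ≡ down c

Touch : Box → Box → Set
Touch b c = b ⋖ c ⊎ c ⋖ b

_⋖?_ : ∀ c b → Dec (c ⋖ b)
c ⋖? b = (b ≟ᴮ right c) ⊎-dec (b ≟ᴮ down c)

touch? : ∀ b c → Dec (Touch b c)
touch? b c = (b ⋖? c) ⊎-dec (c ⋖? b)

Touch-sym : ∀ {b c} → Touch b c → Touch c b
Touch-sym (inj₁ p) = inj₂ p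
Touch-sym (inj₂ p) = inj₁ p

⋖-swap : ∀ {b c} → b ⋖ c → swap b ⋖ swap c
⋖-swap (inj₁ refl) = inj₂ refl
⋖-swap (inj₂ refl) = inj₁ refl

Touch-swap : ∀ {b c} → Touch b c → Touch (swap b) (swap c)
Touch-swap (inj₁ p) = inj₁ (⋖-swap p)
Touch-swap (inj₂ p) = inj₂ (⋖-swap p)

flip : Path → Path
flip = map swap

flip-flip : ∀ x → flip (flip x) ≡ x
flip-flip []      = refl
flip-flip (b ∷ x) = cong (b ∷_) (flip-flip x)

Addable : Box → Path → Set
Addable b r = b ∉ r × (∀ {c} → c ⋖ b → c ∈ r)

-- A valid path lists the boxes of a Young diagram without repetition, so `↭` between valid paths
-- means that they have the same shape.
data Valid : Path → Set where
  []  : Valid []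
  _∷_ : ∀ {b r} → Addable b r → Valid r → Valid (b ∷ r)

Valid-tail : ∀ {b r} → Valid (b ∷ r) → Valid r
Valid-tail (_ ∷ v) = v

∈-flip : ∀ {b x} → b ∈ x → swap b ∈ flip x
∈-flip = ∈-map⁺ swap

∈-unflip : ∀ {b x} → b ∈ flip x → swap b ∈ x
∈-unflip {b} {x} p = subst (swap b ∈_) (flip-flip x) (∈-flip p)

Valid-flip : ∀ {x} → Valid x → Valid (flip x)
Valid-flip [] = []
Valid-flip ((b∉ , cl) ∷ v) =
  ((λ p → b∉ (∈-unflip p)) , (λ p → ∈-flip (cl (⋖-swap p)))) ∷ Valid-flip v

Valid-closed : ∀ {x b c} → Valid x → b ∈ x → c ⋖ b → c ∈ x
Valid-closed ((_ , cl) ∷ v) (here refl) p = there (cl p)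
Valid-closed (_ ∷ v) (there q) p = there (Valid-closed v q p)

Valid-exchange : ∀ {b c r} → Valid (b ∷ c ∷ r) → ¬ Touch b c → Valid (c ∷ b ∷ r)
Valid-exchange {b} {c} {r} ((b∉ , clb) ∷ (c∉ , clc) ∷ v) nt = (c∉′ , λ p → there (clc p)) ∷ (b∉ ∘ there , clb′) ∷ v
  where
  c∉′ : c ∉ b ∷ r
  c∉′ (here refl) = b∉ (here refl)
  c∉′ (there p)   = c∉ p
  clb′ : ∀ {d} → d ⋖ b → d ∈ r
  clb′ p with clb p
  ... | here refl = contradiction (inj₂ p) nt
  ... | there q   = q

-- Consecutive entries can be exchanged exactly if their boxes do not touch: of two touching boxes,
-- one needs the other to be present first.
top : Path → Path
top (b ∷ c ∷ r) with touch? b c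
... | yes _ = b ∷ c ∷ r
... | no  _ = c ∷ b ∷ r
top x = x

top-touch : ∀ {b c r} → Touch b c → top (b ∷ c ∷ r) ≡ b ∷ c ∷ r
top-touch {b} {c} p with touch? b c
... | yes _ = refl
... | no ¬p = contradiction p ¬p

top-apart : ∀ {b c r} → ¬ Touch b c → top (b ∷ c ∷ r) ≡ c ∷ b ∷ r
top-apart {b} {c} ¬p with touch? b c
... | yes p = contradiction p ¬p
... | no _  = refl

top-involutive : ∀ x → top (top x) ≡ x
top-involutive []          = refl
top-involutive (b ∷ [])    = refl
top-involutive (b ∷ c ∷ r) with touch? b c
... | yes p = top-touch p
... | no ¬p = top-apart (¬p ∘ Touch-sym)

top-flip : ∀ x → top (flip x) ≡ flip (top x)
top-flip []          = refl
top-flip (b ∷ [])    = refl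
top-flip (b ∷ c ∷ r) with touch? b c
... | yes p = top-touch (Touch-swap p)
... | no ¬p = top-apart (¬p ∘ Touch-swap)

top-↭ : ∀ x → top x ↭ x
top-↭ []          = ↭-refl
top-↭ (b ∷ [])    = ↭-refl
top-↭ (b ∷ c ∷ r) with touch? b c
... | yes p = ↭-refl
... | no ¬p = ↭-swap c b ↭-refl

top-valid : ∀ {x} → Valid x → Valid (top x)
top-valid {[]}        v = v
top-valid {b ∷ []}    v = v
top-valid {b ∷ c ∷ r} v with touch? b c
... | yes _ = v
... | no ¬p = Valid-exchange v ¬p

-- The i-th and (i+1)-st box are counted from the end of the list.
t : ℕ → Path → Path
t i []      = []
t i (b ∷ r) with length r ≟ i
... | yes _ = top (b ∷ r)
... | no  _ = b ∷ t i r

t-top : ∀ {i} b r → length r ≡ i → t i (b ∷ r) ≡ top (b ∷ r)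
t-top {i} b r e with length r ≟ i
... | yes _ = refl
... | no ¬e = contradiction e ¬e

t-below : ∀ {i} b r → length r ≢ i → t i (b ∷ r) ≡ b ∷ t i r
t-below {i} b r ¬e with length r ≟ i
... | yes e = contradiction e ¬e
... | no _  = refl

t-↭ : ∀ i x → t i x ↭ x
t-↭ i []      = ↭-refl
t-↭ i (b ∷ r) with length r ≟ i
... | yes _ = top-↭ (b ∷ r)
... | no  _ = ↭-prep b (t-↭ i r)

t-length : ∀ i x → length (t i x) ≡ length x
t-length i x = ↭-length (t-↭ i x)

t-valid : ∀ i {x} → Valid x → Valid (t i x)
t-valid i {[]}    v = v
t-valid i {b ∷ r} v with length r ≟ i
... | yes _ = top-valid v
t-valid i {b ∷ r} ((b∉ , cl) ∷ v) | no _ =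
  ((λ p → b∉ (∈-resp-↭ (t-↭ i r) p)) , (λ p → ∈-resp-↭ (↭-sym (t-↭ i r)) (cl p))) ∷ t-valid i v

private
  length-tail-top : ∀ b r → ∃₂ λ c s → top (b ∷ r) ≡ c ∷ s × length s ≡ length r
  length-tail-top b []      = b , [] , refl , refl
  length-tail-top b (c ∷ r) with touch? b c
  ... | yes _ = b , c ∷ r , refl , refl
  ... | no  _ = c , b ∷ r , refl , refl

t-involutive : ∀ i x → t i (t i x) ≡ x
t-involutive i []      = refl
t-involutive i (b ∷ r) with length r ≟ i
... | no ¬e = trans (t-below b (t i r) (¬e ∘ trans (sym (t-length i r)))) (cong (b ∷_) (t-involutive i r))
... | yes e with length-tail-top b r
... | c , s , eq , len rewrite eq = trans (t-top c s (trans len e)) (trans (cong top (sym eq)) (top-involutive (b ∷ r)))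

t-flip : ∀ i x → t i (flip x) ≡ flip (t i x)
t-flip i []      = refl
t-flip i (b ∷ r) with length r ≟ i
... | yes e = trans (t-top (swap b) (flip r) (trans (length-map swap r) e)) (top-flip (b ∷ r))
... | no ¬e = trans (t-below (swap b) (flip r) (¬e ∘ trans (sym (length-map swap r)))) (cong (swap b ∷_) (t-flip i r))

act : List ℕ → Path → Path
act []      x = x
act (i ∷ w) x = t i (act w x)

Word : ℕ → List ℕ → Set
Word n = All (λ i → 1 ≤ i × i < n)

Word-suc : ∀ {n w} → Word n w → Word (suc n) w
Word-suc = All.map (λ (p , q) → p , m<n⇒m<1+n q)

Word-++ : ∀ {n v w} → Word n v → Word n w → Word n (v ++ w)
Word-++ = AllP.++⁺

Word-reverse : ∀ {n w} → Word n w → Word n (reverse w)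
Word-reverse {w = w} = All-resp-↭ (↭-sym (↭-reverse w))

act-++ : ∀ v w x → act (v ++ w) x ≡ act v (act w x)
act-++ []      w x = refl
act-++ (i ∷ v) w x = cong (t i) (act-++ v w x)

act-↭ : ∀ w x → act w x ↭ x
act-↭ []      x = ↭-refl
act-↭ (i ∷ w) x = ↭-trans (t-↭ i (act w x)) (act-↭ w x)

act-length : ∀ w x → length (act w x) ≡ length x
act-length w x = ↭-length (act-↭ w x)

act-valid : ∀ w {x} → Valid x → Valid (act w x)
act-valid []      v = v
act-valid (i ∷ w) v = t-valid i (act-valid w v)

act-flip : ∀ w x → act w (flip x) ≡ flip (act w x)
act-flip []      x = refl
act-flip (i ∷ w) x = trans (cong (t i) (act-flip w x)) (t-flip i (act w x))

act-reverseˡ : ∀ w x → act (reverse w) (act w x) ≡ x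
act-reverseˡ []      x = refl
act-reverseˡ (i ∷ w) x = begin
  act (reverse (i ∷ w)) (t i (act w x))  ≡⟨ cong (λ v → act v (t i (act w x))) (unfold-reverse i w) ⟩
  act (reverse w ∷ʳ i) (t i (act w x))   ≡⟨ act-++ (reverse w) (i ∷ []) _ ⟩
  act (reverse w) (t i (t i (act w x)))  ≡⟨ cong (act (reverse w)) (t-involutive i _) ⟩
  act (reverse w) (act w x)              ≡⟨ act-reverseˡ w x ⟩
  x                                      ∎
  where open ≡-Reasoning

act-injective : ∀ w {x y} → act w x ≡ act w y → x ≡ y
act-injective w {x} {y} e = trans (sym (act-reverseˡ w x)) (trans (cong (act (reverse w)) e) (act-reverseˡ w y))

act-reverseʳ : ∀ w x → act w (act (reverse w) x) ≡ x
act-reverseʳ w x = act-injective (reverse w) (act-reverseˡ w (act (reverse w) x))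

act-∷ : ∀ {w b r} → Word (length r) w → act w (b ∷ r) ≡ b ∷ act w r
act-∷ [] = refl
act-∷ {i ∷ w} {b} {r} ((_ , i<) ∷ ok) = trans (cong (t i) (act-∷ ok))
  (t-below b (act w r) (λ e → <⇒≢ i< (trans (sym e) (act-length w r))))

-- Equality up to transposition

infix 4 _~_ _≁_

_~_ _≁_ : Path → Path → Set
x ~ y = x ≡ y ⊎ x ≡ flip y
x ≁ y = ¬ x ~ y

_~?_ : ∀ x y → Dec (x ~ y)
x ~? y = (x ≟ᴾ y) ⊎-dec (x ≟ᴾ flip y)

~-refl : ∀ {x} → x ~ x
~-refl = inj₁ refl

~-sym : ∀ {x y} → x ~ y → y ~ x
~-sym (inj₁ refl) = inj₁ refl
~-sym {y = y} (inj₂ refl) = inj₂ (sym (flip-flip y))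

~-trans : ∀ {x y z} → x ~ y → y ~ z → x ~ z
~-trans (inj₁ refl) q = q
~-trans (inj₂ refl) (inj₁ refl) = inj₂ refl
~-trans {z = z} (inj₂ refl) (inj₂ refl) = inj₁ (flip-flip z)

~-act : ∀ w {x y} → x ~ y → act w x ~ act w y
~-act w (inj₁ refl) = inj₁ refl
~-act w {y = y} (inj₂ refl) = inj₂ (act-flip w y)

~-act⁻ : ∀ w {x y} → act w x ~ act w y → x ~ y
~-act⁻ w {x} {y} p = subst₂ _~_ (act-reverseˡ w x) (act-reverseˡ w y) (~-act (reverse w) p)

~-tail : ∀ {b c x y} → b ∷ x ~ c ∷ y → x ~ y
~-tail (inj₁ refl) = inj₁ refl
~-tail (inj₂ refl) = inj₂ refl

-- The first two boxes of a path are (0 , 0) and one of its neighbours, and the neighbour is off the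
-- diagonal.
flip-≢ : ∀ {x} → Valid x → 2 ≤ length x → flip x ≢ x
flip-≢ {b ∷ []} v (s≤s ()) e
flip-≢ {b ∷ c ∷ d ∷ r} (_ ∷ v) p e = flip-≢ v (s≤s (s≤s z≤n)) (∷-injectiveʳ e)
flip-≢ {(i , j) ∷ (k , l) ∷ []} ((b∉ , clb) ∷ (_ , clc) ∷ []) p e
  with ∷-injectiveˡ e | ∷-injectiveˡ (∷-injectiveʳ e)
flip-≢ {(zero , zero) ∷ (zero , zero) ∷ []} ((b∉ , _) ∷ _) p e | _ | _ = b∉ (here refl)
flip-≢ {(suc i , suc .i) ∷ (zero , zero) ∷ []} ((_ , clb) ∷ _) p e | refl | _ with clb (inj₁ refl)
... | here ()
... | there ()
flip-≢ {_ ∷ (suc k , l) ∷ []} (_ ∷ (_ , clc) ∷ []) p e | _ | _ with clc (inj₂ refl)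
... | ()

-- Three-cycles modulo transposition

Pt : ℕ → Path → Set
Pt n x = Valid x × length x ≡ n

Pt-~ : ∀ {n x y} → x ~ y → Pt n y → Pt n x
Pt-~ (inj₁ refl) p = p
Pt-~ {y = y} (inj₂ refl) (v , l) = Valid-flip v , trans (length-map swap y) l

Pt-act : ∀ {n x} w → Pt n x → Pt n (act w x)
Pt-act {x = x} w (v , l) = act-valid w v , trans (act-length w x) l

-- The cycle is only required up to transposition of tableaux, but fix is an exact statement
-- about the tableaux of all shapes with n boxes at once.
record Tri (n : ℕ) (a b c : Path) : Set where
  field
    word : List ℕ
    word-ok : Word n word
    ptᵃ : Pt n a
    ptᵇ : Pt n b
    ptᶜ : Pt n c
    a≁b : a ≁ b
    b≁c : b ≁ c
    c≁a : c ≁ a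
    a→b : act word a ~ b
    b→c : act word b ~ c
    c→a : act word c ~ a
    fix : ∀ {x} → Pt n x → x ≁ a → x ≁ b → x ≁ c → act word x ≡ x

Tri-rot : ∀ {n a b c} → Tri n a b c → Tri n b c a
Tri-rot τ = record
  { word = word ; word-ok = word-ok ; ptᵃ = ptᵇ ; ptᵇ = ptᶜ ; ptᶜ = ptᵃ
  ; a≁b = b≁c ; b≁c = c≁a ; c≁a = a≁b ; a→b = b→c ; b→c = c→a ; c→a = a→b
  ; fix = λ p x≁b x≁c x≁a → fix p x≁a x≁b x≁c }
  where open Tri τ

private
  act-reverse-~ : ∀ w {x y} → act w x ~ y → act (reverse w) y ~ x
  act-reverse-~ w {x} {y} p = ~-sym (subst (_~ act (reverse w) y) (act-reverseˡ w x) (~-act (reverse w) p))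

  act-reverse-fix : ∀ w {x} → act w x ≡ x → act (reverse w) x ≡ x
  act-reverse-fix w {x} e = trans (cong (act (reverse w)) (sym e)) (act-reverseˡ w x)

Tri-reverse : ∀ {n a b c} → Tri n a b c → Tri n a c b
Tri-reverse τ = record
  { word = reverse word ; word-ok = Word-reverse word-ok ; ptᵃ = ptᵃ ; ptᵇ = ptᶜ ; ptᶜ = ptᵇ
  ; a≁b = c≁a ∘ ~-sym ; b≁c = b≁c ∘ ~-sym ; c≁a = a≁b ∘ ~-sym
  ; a→b = act-reverse-~ word c→a ; b→c = act-reverse-~ word b→c ; c→a = act-reverse-~ word a→b
  ; fix = λ p x≁a x≁c x≁b → act-reverse-fix word (fix p x≁a x≁b x≁c) }
  where open Tri τ

Tri-swap : ∀ {n a b c} → Tri n a b c → Tri n b a c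
Tri-swap τ = Tri-reverse (Tri-rot τ)

Tri-resp : ∀ {n a b c a′ b′ c′} → a′ ~ a → b′ ~ b → c′ ~ c → Tri n a b c → Tri n a′ b′ c′
Tri-resp p q r τ = record
  { word = word ; word-ok = word-ok ; ptᵃ = Pt-~ p ptᵃ ; ptᵇ = Pt-~ q ptᵇ ; ptᶜ = Pt-~ r ptᶜ
  ; a≁b = λ s → a≁b (~-trans (~-sym p) (~-trans s q))
  ; b≁c = λ s → b≁c (~-trans (~-sym q) (~-trans s r))
  ; c≁a = λ s → c≁a (~-trans (~-sym r) (~-trans s p))
  ; a→b = ~-trans (~-act word p) (~-trans a→b (~-sym q))
  ; b→c = ~-trans (~-act word q) (~-trans b→c (~-sym r))
  ; c→a = ~-trans (~-act word r) (~-trans c→a (~-sym p))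
  ; fix = λ x x≁a x≁b x≁c → fix x (λ s → x≁a (~-trans s (~-sym p)))
      (λ s → x≁b (~-trans s (~-sym q))) (λ s → x≁c (~-trans s (~-sym r))) }
  where open Tri τ

Tri-act : ∀ {n a b c} v → Word n v → Tri n a b c → Tri n (act v a) (act v b) (act v c)
Tri-act {n} {a} {b} {c} v vok τ = record
  { word = v ++ word ++ reverse v
  ; word-ok = Word-++ vok (Word-++ word-ok (Word-reverse vok))
  ; ptᵃ = Pt-act v ptᵃ ; ptᵇ = Pt-act v ptᵇ ; ptᶜ = Pt-act v ptᶜ
  ; a≁b = a≁b ∘ ~-act⁻ v ; b≁c = b≁c ∘ ~-act⁻ v ; c≁a = c≁a ∘ ~-act⁻ v
  ; a→b = moves a→b ; b→c = moves b→c ; c→a = moves c→a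
  ; fix = λ {x} p x≁a x≁b x≁c → trans (conj x) (trans
      (cong (act v) (fix (Pt-act (reverse v) p) (back x≁a) (back x≁b) (back x≁c)))
      (act-reverseʳ v x)) }
  where
  open Tri τ
  conj : ∀ x → act (v ++ word ++ reverse v) x ≡ act v (act word (act (reverse v) x))
  conj x = trans (act-++ v _ x) (cong (act v) (act-++ word _ x))
  moves : ∀ {x y} → act word x ~ y → act (v ++ word ++ reverse v) (act v x) ~ act v y
  moves {x} p = subst (_~ _)
    (sym (trans (conj (act v x)) (cong (act v ∘ act word) (act-reverseˡ v x)))) (~-act v p)
  back : ∀ {x y} → x ≁ act v y → act (reverse v) x ≁ y
  back {x} ne p = ne (subst (_~ _) (act-reverseʳ v x) (~-act v p))

-- Conjugate (a b d) by (a b c), which takes a to b, b to c and fixes d. `Tri-share₁` conjugates (a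
-- d e) in the same way.
Tri-share₂ : ∀ {n a b c d} → Tri n a b c → Tri n a b d → d ≁ c → Tri n b c d
Tri-share₂ τ σ d≁c = Tri-resp (~-sym a→b) (~-sym b→c)
    (inj₁ (sym (fix (Tri.ptᶜ σ) (Tri.c≁a σ) (Tri.b≁c σ ∘ ~-sym) d≁c))) (Tri-act word word-ok σ)
  where open Tri τ

Tri-share₁ : ∀ {n a b c d e} → Tri n a b c → Tri n a d e →
  d ≁ b → d ≁ c → e ≁ b → e ≁ c → Tri n b d e
Tri-share₁ τ σ d≁b d≁c e≁b e≁c = Tri-resp (~-sym a→b)
    (inj₁ (sym (fix (Tri.ptᵇ σ) (Tri.a≁b σ ∘ ~-sym) d≁b d≁c)))
    (inj₁ (sym (fix (Tri.ptᶜ σ) (Tri.c≁a σ) e≁b e≁c))) (Tri-act word word-ok σ)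
  where open Tri τ

-- Two 3-cycles with a common point generate all 3-cycles on their points. If the five points are
-- distinct, a first conjugation gives (x w v), which shares two points with (y w v), and a second
-- one finishes. This is the transitivity of `≈[ n ]`.
Tri-glue : ∀ {n x y z w v} → Tri n x y z → Tri n y w v → x ≁ w → Tri n x y w
Tri-glue {n} {x} {y} {z} {w} {v} τ σ x≁w with w ~? z
... | yes w~z = Tri-resp ~-refl ~-refl w~z τ
... | no w≁z with v ~? x
... | yes v~x = Tri-rot (Tri-rot (Tri-resp ~-refl ~-refl (~-sym v~x) σ))
... | no v≁x with v ~? z
... | yes v~z = Tri-swap (Tri-share₂ (Tri-rot (Tri-rot τ′)) (Tri-rot (Tri-rot σ′)) (x≁w ∘ ~-sym))
  where
  τ′ : Tri n y x z
  τ′ = Tri-swap τ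
  σ′ : Tri n y w z
  σ′ = Tri-resp ~-refl ~-refl (~-sym v~z) σ
... | no v≁z = Tri-swap (Tri-rot (Tri-share₂ (Tri-reverse (Tri-rot (Tri-rot σ)))
                 (Tri-reverse (Tri-rot (Tri-rot ρ))) (Tri.a≁b τ)))
  where
  ρ : Tri n x w v
  ρ = Tri-share₁ (Tri-swap τ) σ (x≁w ∘ ~-sym) w≁z v≁x v≁z

infix 4 _≈[_]_

_≈[_]_ : Path → ℕ → Path → Set
x ≈[ n ] y = x ~ y ⊎ ∃ (Tri n x y)

≈-sym : ∀ {n x y} → x ≈[ n ] y → y ≈[ n ] x
≈-sym (inj₁ p)       = inj₁ (~-sym p)
≈-sym (inj₂ (z , τ)) = inj₂ (z , Tri-swap τ)

≈-trans : ∀ {n x y z} → x ≈[ n ] y → y ≈[ n ] z → x ≈[ n ] z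
≈-trans (inj₁ p) (inj₁ q) = inj₁ (~-trans p q)
≈-trans (inj₁ p) (inj₂ (w , τ)) = inj₂ (w , Tri-resp p ~-refl ~-refl τ)
≈-trans (inj₂ (w , τ)) (inj₁ q) = inj₂ (w , Tri-resp ~-refl (~-sym q) ~-refl τ)
≈-trans {x = x} {y} {z} (inj₂ (_ , τ)) (inj₂ (_ , σ)) with x ~? z
... | yes p = inj₁ p
... | no ¬p = inj₂ (y , Tri-reverse (Tri-glue τ σ ¬p))

≈-act : ∀ {n x y} v → Word n v → x ≈[ n ] y → act v x ≈[ n ] act v y
≈-act v ok (inj₁ p)       = inj₁ (~-act v p)
≈-act v ok (inj₂ (z , τ)) = inj₂ (act v z , Tri-act v ok τ)

≈⇒Tri : ∀ {n x y z} → x ≈[ n ] y → y ≈[ n ] z → x ≁ y → y ≁ z → x ≁ z → Tri n x y z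
≈⇒Tri (inj₁ p) _ x≁y _ _ = contradiction p x≁y
≈⇒Tri (inj₂ _) (inj₁ p) _ y≁z _ = contradiction p y≁z
≈⇒Tri (inj₂ (_ , τ)) (inj₂ (_ , σ)) _ _ x≁z = Tri-glue τ σ x≁z

-- If the supports of f and h meet in one point A only, then [f , h] is the 3-cycle (A , f A , h A).
commutator-Tri : ∀ {n A} w v → Word n w → Word n v → Pt n A →
  act w A ≁ A → act v A ≁ A →
  (∀ {x} → Pt n x → act w x ≡ x ⊎ act v x ≡ x ⊎ x ~ A) →
  Tri n A (act w A) (act v A)
commutator-Tri {n} {A} w v wok vok pA fA≁A hA≁A meet = record
  { word = w ++ v ++ reverse w ++ reverse v
  ; word-ok = Word-++ wok (Word-++ vok (Word-++ (Word-reverse wok) (Word-reverse vok)))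
  ; ptᵃ = pA ; ptᵇ = Pt-act w pA ; ptᶜ = Pt-act v pA
  ; a≁b = fA≁A ∘ ~-sym
  ; b≁c = fA≁hA
  ; c≁a = hA≁A
  ; a→b = inj₁ (at A (act-reverse-fix w f-h⁻¹A) (act-reverseʳ v A))
  ; b→c = inj₁ (trans (compute (f A))
      (trans (cong (f ∘ h ∘ f⁻¹) (act-reverse-fix v h-fA))
      (trans (cong (f ∘ h) (act-reverseˡ w A)) f-hA)))
  ; c→a = inj₁ (trans (compute (h A))
      (trans (cong (f ∘ h ∘ f⁻¹) (act-reverseˡ v A))
      (trans (cong f h-f⁻¹A) (act-reverseʳ w A))))
  ; fix = λ p x≁A x≁fA x≁hA → fixed p x≁A x≁fA x≁hA (meet p) }
  where
  f h f⁻¹ h⁻¹ : Path → Path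
  f = act w
  h = act v
  f⁻¹ = act (reverse w)
  h⁻¹ = act (reverse v)
  compute : ∀ x → act (w ++ v ++ reverse w ++ reverse v) x ≡ f (h (f⁻¹ (h⁻¹ x)))
  compute x = trans (act-++ w _ x) (cong f (trans (act-++ v _ x) (cong h (act-++ (reverse w) _ x))))
  at : ∀ {y} x → f⁻¹ (h⁻¹ x) ≡ h⁻¹ x → h (h⁻¹ x) ≡ y → act (w ++ v ++ reverse w ++ reverse v) x ≡ f y
  at x e e′ = trans (compute x) (cong f (trans (cong h e) e′))
  h-fA : h (f A) ≡ f A
  h-fA with meet (Pt-act w pA)
  ... | inj₁ e        = contradiction (inj₁ (act-injective w e)) fA≁A
  ... | inj₂ (inj₁ e) = e
  ... | inj₂ (inj₂ p) = contradiction p fA≁A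
  f-hA : f (h A) ≡ h A
  f-hA with meet (Pt-act v pA)
  ... | inj₁ e        = e
  ... | inj₂ (inj₁ e) = contradiction (inj₁ (act-injective v e)) hA≁A
  ... | inj₂ (inj₂ p) = contradiction p hA≁A
  h-f⁻¹A : h (f⁻¹ A) ≡ f⁻¹ A
  h-f⁻¹A with meet (Pt-act (reverse w) pA)
  ... | inj₁ e        = contradiction (inj₁ (trans (cong f (trans (sym (act-reverseʳ w A)) e)) (act-reverseʳ w A))) fA≁A
  ... | inj₂ (inj₁ e) = e
  ... | inj₂ (inj₂ p) = contradiction (~-sym (subst (_~ f A) (act-reverseʳ w A) (~-act w p))) fA≁A
  f-h⁻¹A : f (h⁻¹ A) ≡ h⁻¹ A
  f-h⁻¹A with meet (Pt-act (reverse v) pA)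
  ... | inj₁ e        = e
  ... | inj₂ (inj₁ e) = contradiction (inj₁ (trans (cong h (trans (sym (act-reverseʳ v A)) e)) (act-reverseʳ v A))) hA≁A
  ... | inj₂ (inj₂ p) = contradiction (~-sym (subst (_~ h A) (act-reverseʳ v A) (~-act v p))) hA≁A
  fA≁hA : f A ≁ h A
  -- `f` fixes `h A`, hence its whole class; `f A ~ h A` would make `f` fix `f A`, and then `A`.
  fA≁hA p = fA≁A (inj₁ (act-injective w
    (case p of λ where
      (inj₁ e) → trans (cong f e) (trans f-hA (sym e))
      (inj₂ e) → trans (cong f e) (trans (act-flip w (h A)) (trans (cong flip f-hA) (sym e))))))
  fixed : ∀ {x} → Pt n x → x ≁ A → x ≁ f A → x ≁ h A → f x ≡ x ⊎ h x ≡ x ⊎ x ~ A →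
    act (w ++ v ++ reverse w ++ reverse v) x ≡ x
  -- Once `f` fixes `h⁻¹ x`, the commutator sends `x` to `f x`. The other two outcomes of `meet` at
  -- `h⁻¹ x` are harmless: if `h` fixes this point, it is `x` itself; if it is in the class of `A`,
  -- then `x ~ h A`.
  fixed {x} p x≁A x≁fA x≁hA (inj₁ fx) = trans (at x (act-reverse-fix w lemma) (act-reverseʳ v x)) fx
    where
    lemma : f (h⁻¹ x) ≡ h⁻¹ x
    lemma with meet (Pt-act (reverse v) p)
    ... | inj₁ e        = e
    ... | inj₂ (inj₁ e) = subst (λ y → f y ≡ y) (trans (sym (act-reverseʳ v x)) e) fx
    ... | inj₂ (inj₂ q) = contradiction (subst (_~ h A) (act-reverseʳ v x) (~-act v q)) x≁hA
  fixed {x} p x≁A x≁fA x≁hA (inj₂ (inj₁ hx)) = trans (compute x)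
      (trans (cong (f ∘ h ∘ f⁻¹) (act-reverse-fix v hx)) (trans (cong f lemma) (act-reverseʳ w x)))
    where
    lemma : h (f⁻¹ x) ≡ f⁻¹ x
    lemma with meet (Pt-act (reverse w) p)
    ... | inj₁ e        = subst (λ y → h y ≡ y) (trans (sym (act-reverseʳ w x)) e) hx
    ... | inj₂ (inj₁ e) = e
    ... | inj₂ (inj₂ q) = contradiction (subst (_~ f A) (act-reverseʳ w x) (~-act w q)) x≁fA
  fixed p x≁A _ _ (inj₂ (inj₂ q)) = contradiction q x≁A

-- Corners and transitivity

Unique-⊆-length : ∀ {A : Set} {xs ys : List A} → Unique xs → xs ⊆ ys → length xs ≤ length ys
Unique-⊆-↭ : ∀ {A : Set} {xs ys : List A} → Unique xs → xs ⊆ ys → length ys ≤ length xs → xs ↭ ys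

private
  ⊆-remove : ∀ {A : Set} {x : A} {xs ys : List A} → All (x ≢_) xs → x ∷ xs ⊆ ys →
    ∃ λ zs → ys ↭ x ∷ zs × xs ⊆ zs
  ⊆-remove {x = x} {xs} x∉ sub with ∈-∃++ (sub (here refl))
  ... | as , bs , refl = as ++ bs , shift x as bs , λ {y} p → drop y p (∈-resp-↭ (shift x as bs) (sub (there p)))
    where
    drop : ∀ y → y ∈ xs → y ∈ x ∷ as ++ bs → y ∈ as ++ bs
    drop y p (here refl) = contradiction refl (All.lookup x∉ p)
    drop y p (there q)   = q

Unique-⊆-length [] sub = z≤n
Unique-⊆-length (x∉ ∷ u) sub with ⊆-remove x∉ sub
... | zs , ys↭ , sub′ = subst (_ ≤_) (sym (↭-length ys↭)) (s≤s (Unique-⊆-length u sub′))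

Unique-⊆-↭ {ys = []} [] sub len = ↭-refl
Unique-⊆-↭ {ys = _ ∷ _} [] sub ()
Unique-⊆-↭ (x∉ ∷ u) sub len with ⊆-remove x∉ sub
... | zs , ys↭ , sub′ with subst (_≤ _) (↭-length ys↭) len
... | s≤s len′ = ↭-trans (↭-prep _ (Unique-⊆-↭ u sub′ len′)) (↭-sym ys↭)

Valid-unique : ∀ {x} → Valid x → Unique x
Valid-unique [] = []
Valid-unique ((b∉ , _) ∷ v) = AllP.¬Any⇒All¬ _ b∉ ∷ Valid-unique v

Valid-∷-↭ : ∀ {b r s} → Valid (b ∷ r) → Valid s → s ↭ r → Valid (b ∷ s)
Valid-∷-↭ ((b∉ , cl) ∷ _) v p = (b∉ ∘ ∈-resp-↭ p , λ q → ∈-resp-↭ (↭-sym p) (cl q)) ∷ v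

_∈?_ : ∀ (b : Box) x → Dec (b ∈ x)
b ∈? x = any? (b ≟ᴮ_) x

infix 4 _≼_

_≼_ : Box → Box → Set
(i , j) ≼ (k , l) = i ≤ k × j ≤ l

_≼?_ : ∀ b c → Dec (b ≼ c)
(i , j) ≼? (k , l) = (i ≤? k) ×-dec (j ≤? l)

≼-refl : ∀ {b} → b ≼ b
≼-refl = ≤-refl , ≤-refl

≼-trans : ∀ {b c d} → b ≼ c → c ≼ d → b ≼ d
≼-trans (p , q) (p′ , q′) = ≤-trans p p′ , ≤-trans q q′

⋖⇒≼ : ∀ {b c} → b ⋖ c → b ≼ c
⋖⇒≼ (inj₁ refl) = ≤-refl , n≤1+n _
⋖⇒≼ (inj₂ refl) = n≤1+n _ , ≤-refl

⋖-irrefl : ∀ {b} → ¬ b ⋖ b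
⋖-irrefl (inj₁ ())
⋖-irrefl (inj₂ ())

Valid-closed-≼ : ∀ {x b c} → Valid x → b ∈ x → c ≼ b → c ∈ x
Valid-closed-≼ {x} {i , j} {k , l} v p (k≤i , l≤j) = rows i k≤i (cols j l≤j p)
  where
  cols : ∀ j → l ≤ j → (i , j) ∈ x → (i , l) ∈ x
  cols j l≤j p with l ≟ j
  ... | yes refl = p
  cols zero z≤n p | no l≢ = contradiction refl l≢
  cols (suc j) l≤j p | no l≢ with ≤∧≢⇒< l≤j l≢
  ... | s≤s l≤ = cols j l≤ (Valid-closed v p (inj₁ refl))
  rows : ∀ i → k ≤ i → (i , l) ∈ x → (k , l) ∈ x
  rows i k≤i p with k ≟ i
  ... | yes refl = p
  rows zero z≤n p | no k≢ = contradiction refl k≢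
  rows (suc i) k≤i p | no k≢ with ≤∧≢⇒< k≤i k≢
  ... | s≤s k≤ = rows i k≤ (Valid-closed v p (inj₂ refl))

Corner : Box → Path → Set
Corner p x = ∀ {c} → p ⋖ c → c ∉ x

Corner-↭ : ∀ {p x y} → x ↭ y → Corner p x → Corner p y
Corner-↭ e co q c∈ = co q (∈-resp-↭ (↭-sym e) c∈)

Corner-head : ∀ {p r} → Valid (p ∷ r) → Corner p (p ∷ r)
Corner-head _ q (here refl) = ⋖-irrefl q
Corner-head ((p∉ , _) ∷ v) q (there c∈) = p∉ (Valid-closed v c∈ q)

Corner-≼ : ∀ {p x b} → Valid x → Corner p x → b ∈ x → p ≼ b → b ≡ p
Corner-≼ {i , j} {x} {k , l} v co b∈ (i≤k , j≤l) with i ≟ k | j ≟ l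
... | yes refl | yes refl = refl
... | no i≢ | _ = contradiction (Valid-closed-≼ v b∈ (≤∧≢⇒< i≤k i≢ , j≤l)) (co (inj₂ refl))
... | yes refl | no j≢ = contradiction (Valid-closed-≼ v b∈ (≤-refl , ≤∧≢⇒< j≤l j≢)) (co (inj₁ refl))

-- Among the boxes that dominate `b`, take the one added last: a box that it blocks would dominate
-- `b` too and have been added later.
corner-above : ∀ {x b} → Valid x → b ∈ x → ∃ λ c → c ∈ x × b ≼ c × Corner c x
corner-above {d ∷ r} {b} V@(_ ∷ v) b∈ with b ≼? d
... | yes b≼d = d , here refl , b≼d , Corner-head V
corner-above {d ∷ r} {b} V@(_ ∷ v) (here refl) | no b⋠d = contradiction ≼-refl b⋠d
corner-above {d ∷ r} {b} V@(_ ∷ v) (there b∈) | no b⋠d with corner-above v b∈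
... | c , c∈ , b≼c , co = c , there c∈ , b≼c , co′
  where
  co′ : Corner c (d ∷ r)
  co′ q (here refl) = b⋠d (≼-trans b≼c (⋖⇒≼ q))
  co′ q (there e∈)  = co q e∈

pull : ∀ {x p} → Valid x → p ∈ x → Corner p x → ∃ λ r → Valid (p ∷ r) × x ↭ p ∷ r
pull {_ ∷ s} v (here refl) co = s , v , ↭-refl
pull {b ∷ s} {p} ((b∉ , cl) ∷ v) (there p∈) co with pull v p∈ (λ q e → co q (there e))
... | r , V@((p∉ , clp) ∷ vr) , s↭ = b ∷ r , Valid-exchange (Valid-∷-↭ ((b∉ , cl) ∷ v) V (↭-sym s↭)) nt ,
        ↭-trans (↭-prep b s↭) (↭-swap b p ↭-refl)
  where
  nt : ¬ Touch b p
  nt (inj₁ b⋖p) = b∉ (∈-resp-↭ (↭-sym s↭) (there (clp b⋖p)))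
  nt (inj₂ p⋖b) = co p⋖b (here refl)

heads-apart : ∀ {p q r} → Valid (p ∷ q ∷ r) → Corner q (p ∷ q ∷ r) → ¬ Touch p q
heads-apart ((p∉ , _) ∷ (_ , clq) ∷ _) co (inj₁ p⋖q) = p∉ (there (clq p⋖q))
heads-apart _ co (inj₂ q⋖p) = co q⋖p (here refl)

-- If the last boxes `p` and `q` differ, rearrange the tableau below `p` so that `q` comes directly
-- before it, exchange the two by `t n`, and rearrange what is now below `q`.
transitive : ∀ n {x y} → Pt n x → Valid y → x ↭ y → ∃ λ w → Word n w × act w x ≡ y
transitive zero {[]} {y} _ _ x↭y with y | ↭-length x↭y
... | [] | _ = [] , [] , refl
transitive (suc n) {p ∷ r} {[]} _ _ x↭y with ↭-length x↭y
... | ()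
transitive (suc n) {p ∷ r} {q ∷ s} (V@(_ ∷ vr) , len) W@(_ ∷ vs) x↭y with p ≟ᴮ q
... | yes refl with transitive n (vr , suc-injective len) vs (drop-∷ x↭y)
... | w , ok , e = w , Word-suc ok ,
      trans (act-∷ (subst (λ k → Word k w) (sym (suc-injective len)) ok)) (cong (p ∷_) e)
transitive (suc n) {p ∷ r} {q ∷ s} (V@(_ ∷ vr) , len) W@(_ ∷ vs) x↭y | no p≢q
  with ∈-resp-↭ (↭-sym x↭y) (here refl)
... | here refl = contradiction refl p≢q
... | there q∈r with pull vr q∈r (λ c e → Corner-↭ (↭-sym x↭y) (Corner-head W) c (there e))
... | r′ , Vq@(_ ∷ vr′) , r↭ = w₂ ++ n ∷ w₁ , Word-++ (Word-suc ok₂) ((n≥1 , n<1+n n) ∷ Word-suc ok₁) , eq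
  where
  len-r : length r ≡ n
  len-r = suc-injective len
  IH₁ : ∃ λ w → Word n w × act w r ≡ q ∷ r′
  IH₁ = transitive n (vr , len-r) Vq r↭
  w₁ : List ℕ
  w₁ = proj₁ IH₁
  ok₁ : Word n w₁
  ok₁ = proj₁ (proj₂ IH₁)
  V′ : Valid (p ∷ q ∷ r′)
  V′ = Valid-∷-↭ V Vq (↭-sym r↭)
  co : Corner q (p ∷ q ∷ r′)
  co = Corner-↭ (↭-trans (↭-sym x↭y) (↭-prep p r↭)) (Corner-head W)
  apart : ¬ Touch p q
  apart = heads-apart V′ co
  Vp : Valid (p ∷ r′)
  Vp = Valid-tail (Valid-exchange V′ apart)
  len-r′ : length (q ∷ r′) ≡ n
  len-r′ = trans (sym (↭-length r↭)) len-r
  n≥1 : 1 ≤ n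
  n≥1 = subst (1 ≤_) len-r′ (s≤s z≤n)
  p∷r′↭s : p ∷ r′ ↭ s
  p∷r′↭s = drop-∷ (↭-trans (↭-swap q p ↭-refl) (↭-trans (↭-prep p (↭-sym r↭)) x↭y))
  IH₂ : ∃ λ w → Word n w × act w (p ∷ r′) ≡ s
  IH₂ = transitive n (Vp , len-r′) vs p∷r′↭s
  w₂ : List ℕ
  w₂ = proj₁ IH₂
  ok₂ : Word n w₂
  ok₂ = proj₁ (proj₂ IH₂)
  open ≡-Reasoning
  eq : act (w₂ ++ n ∷ w₁) (p ∷ r) ≡ q ∷ s
  eq = begin
    act (w₂ ++ n ∷ w₁) (p ∷ r)      ≡⟨ act-++ w₂ (n ∷ w₁) (p ∷ r) ⟩
    act w₂ (t n (act w₁ (p ∷ r)))   ≡⟨ cong (act w₂ ∘ t n) (act-∷ (subst (λ k → Word k w₁) (sym len-r) ok₁)) ⟩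
    act w₂ (t n (p ∷ act w₁ r))     ≡⟨ cong (λ u → act w₂ (t n (p ∷ u))) (proj₂ (proj₂ IH₁)) ⟩
    act w₂ (t n (p ∷ q ∷ r′))       ≡⟨ cong (act w₂) (t-top p (q ∷ r′) len-r′) ⟩
    act w₂ (top (p ∷ q ∷ r′))       ≡⟨ cong (act w₂) (top-apart apart) ⟩
    act w₂ (q ∷ p ∷ r′)             ≡⟨ act-∷ (subst (λ k → Word k w₂) (sym len-r′) ok₂) ⟩
    q ∷ act w₂ (p ∷ r′)             ≡⟨ cong (q ∷_) (proj₂ (proj₂ IH₂)) ⟩
    q ∷ s                           ∎

-- For a shape with at least three classes of tableaux this says that all the cycles Tri are available (≈⇒Tri).
Connected : ℕ → Path → Set
Connected n x = ∀ {y} → Pt n y → y ↭ x → y ≈[ n ] x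

Connected-↭ : ∀ {n x y} → Pt n y → y ↭ x → Connected n x → Connected n y
Connected-↭ py e con pz e′ = ≈-trans (con pz (↭-trans e′ e)) (≈-sym (con py e))

Connected-~ : ∀ {n x y} → y ~ x → Connected n x → Connected n y
Connected-~ (inj₁ refl) con = con
Connected-~ {n} {x} (inj₂ refl) con {z} pz e =
  ≈-trans (inj₁ (inj₂ (sym (flip-flip z))))
  (≈-trans (con (Pt-~ (inj₂ refl) pz) (subst (flip z ↭_) (flip-flip x) (map⁺ swap e))) (inj₁ (inj₂ (sym (flip-flip x)))))

-- The generators preserve `≈[ n ]` and act transitively on the shape, so it is enough to look at
-- their images of one tableau.
stable⇒Connected : ∀ {n x} → Pt n x → (∀ i → 1 ≤ i → i < n → t i x ≈[ n ] x) → Connected n x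
stable⇒Connected {n} {x} px stable {y} py y↭x with transitive n px (proj₁ py) (↭-sym y↭x)
... | w , ok , refl = orbit w ok
  where
  orbit : ∀ w → Word n w → act w x ≈[ n ] x
  orbit []      []             = inj₁ ~-refl
  orbit (i ∷ w) ((p , q) ∷ ok) = ≈-trans (≈-act (i ∷ []) ((p , q) ∷ []) (orbit w ok)) (stable i p q)

Full : ℕ → Set
Full n = ∀ {x} → Pt n x → (1 , 1) ∈ x → Connected n x

SelfT : Path → Set
SelfT x = ∀ {b} → b ∈ x → swap b ∈ x

-- What lets `p ∷_` respect `~` on the shape of `u`: if that shape is not self-transpose, equivalent
-- tableaux in it are equal; if `p` is on the diagonal, `p ∷ flip y` is `flip (p ∷ y)`.
Good : Box → Path → Set
Good p u = swap p ≡ p ⊎ ¬ SelfT u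

Good-~ : ∀ {p u y z} → Good p u → y ↭ u → z ↭ u → y ~ z → p ∷ y ~ p ∷ z
Good-~ g _ _ (inj₁ refl) = inj₁ refl
Good-~ {z = z} (inj₁ e) _ _ (inj₂ refl) = inj₂ (cong (_∷ flip z) (sym e))
Good-~ (inj₂ ¬s) e e′ (inj₂ refl) =
  ⊥-elim (¬s (λ b∈ → ∈-resp-↭ e (∈-flip (∈-resp-↭ (↭-sym e′) b∈))))

Pt-tail : ∀ {n b r} → Pt (suc n) (b ∷ r) → Pt n r
Pt-tail (_ ∷ v , e) = v , suc-injective e

Pt-∷ : ∀ {n b r s} → Pt (suc n) (b ∷ r) → Pt n s → s ↭ r → Pt (suc n) (b ∷ s)
Pt-∷ (v , _) (v′ , l) e = Valid-∷-↭ v v′ e , cong suc l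

-- The cycle (u v y) of the smaller shape carries the pair p ∷ u, p ∷ v to p ∷ v, p ∷ y.
spread : ∀ {n p u v} → Full n → (1 , 1) ∈ u → Pt (suc n) (p ∷ u) → Pt n v → v ↭ u → u ≁ v → Good p u →
  p ∷ u ≈[ suc n ] p ∷ v → ∀ {y} → Pt n y → y ↭ u → p ∷ y ≈[ suc n ] p ∷ u
spread {n} {p} {u} {v} full 11∈ pu pv v↭u u≁v good u≈v {y} py y↭u with y ~? u | y ~? v
... | yes y~u | _ = inj₁ (Good-~ good y↭u ↭-refl y~u)
... | no _ | yes y~v = ≈-trans (inj₁ (Good-~ good y↭u v↭u y~v)) (≈-sym u≈v)
... | no y≁u | no y≁v = ≈-trans (inj₁ (~-sym (moves v↭u y↭u b→c)))
        (≈-trans (≈-act word (Word-suc word-ok) (≈-sym u≈v)) (≈-trans (inj₁ (moves ↭-refl v↭u a→b)) (≈-sym u≈v)))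
  where
  con : Connected n u
  con = full (Pt-tail pu) 11∈
  τ : Tri n u v y
  τ = ≈⇒Tri (≈-sym (con pv v↭u)) (≈-trans (con pv v↭u) (≈-sym (con py y↭u))) u≁v (y≁v ∘ ~-sym) (y≁u ∘ ~-sym)
  open Tri τ
  moves : ∀ {a b} → a ↭ u → b ↭ u → act word a ~ b → act word (p ∷ a) ~ p ∷ b
  moves {a} a↭ b↭ e = subst (_~ _)
    (sym (act-∷ (subst (λ k → Word k word) (sym (trans (↭-length a↭) (proj₂ (Pt-tail pu)))) word-ok)))
    (Good-~ good (↭-trans (act-↭ word a) a↭) b↭ e)

-- Generators below n keep the head p, so only tₙ has to be checked.
over⇒Connected : ∀ {n p u y} → Pt (suc n) (p ∷ u) →
  (∀ {y} → Pt n y → y ↭ u → p ∷ y ≈[ suc n ] p ∷ u) →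
  Pt n y → y ↭ u → t n (p ∷ y) ≈[ suc n ] p ∷ y → Connected (suc n) (p ∷ u)
over⇒Connected {n} {p} {u} {y} pu over py y↭u fixed =
  Connected-↭ pu (↭-prep p (↭-sym y↭u)) (stable⇒Connected py′ stable)
  where
  py′ : Pt (suc n) (p ∷ y)
  py′ = Pt-∷ pu py y↭u
  stable : ∀ i → 1 ≤ i → i < suc n → t i (p ∷ y) ≈[ suc n ] p ∷ y
  stable i 1≤i (s≤s i≤n) with i ≟ n
  ... | yes refl = fixed
  ... | no i≢n = subst (_≈[ suc n ] _) (sym (t-below p y (λ e → i≢n (trans (sym e) (proj₂ py)))))
        (≈-trans (over (Pt-act (i ∷ []) py) (↭-trans (t-↭ i y) y↭u)) (≈-sym (over py y↭u)))

-- The commutator step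

-- Two 3-cycles with one common point occupy five classes: members 0, 1, 2 go into the cycle over
-- `p`, members 0, 3, 4 into the one over `q`. The shape (3,2) has exactly five tableaux.
record Five (n : ℕ) (x : Path) : Set where
  field
    member   : Fin 5 → Path
    pt       : ∀ i → Pt n (member i)
    shape    : ∀ i → member i ↭ x
    distinct : ∀ {i j} → i ≢ j → member i ≁ member j

Five-↭ : ∀ {n x y} → x ↭ y → Five n x → Five n y
Five-↭ e five = record { member = member ; pt = pt ; shape = λ i → ↭-trans (shape i) e ; distinct = distinct }
  where open Five five

Five-∷ : ∀ {n p r} → Valid (p ∷ r) → Five n r → Five (suc n) (p ∷ r)
Five-∷ {p = p} v five = record
  { member   = λ i → p ∷ member i
  ; pt       = λ i → Valid-∷-↭ v (proj₁ (pt i)) (shape i) , cong suc (proj₂ (pt i))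
  ; shape    = λ i → ↭-prep p (shape i)
  ; distinct = λ ne e → distinct ne (~-tail e) }
  where open Five five

Tri-moved : ∀ {n a b c x} (τ : Tri n a b c) → Pt n x → act (Tri.word τ) x ≢ x → x ~ a ⊎ x ~ b ⊎ x ~ c
Tri-moved {a = a} {b} {c} {x} τ px moved with x ~? a | x ~? b | x ~? c
... | yes p | _ | _ = inj₁ p
... | no _ | yes p | _ = inj₂ (inj₁ p)
... | no _ | no _ | yes p = inj₂ (inj₂ p)
... | no x≁a | no x≁b | no x≁c = contradiction (Tri.fix τ px x≁a x≁b x≁c) moved

top-tails : ∀ b c v → ∃₂ λ b′ c′ → top (b ∷ c ∷ v) ≡ b′ ∷ c′ ∷ v
top-tails b c v with touch? b c
... | yes _ = b , c , refl
... | no  _ = c , b , refl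

-- One equivalent pair of tableaux over `p`, from which `spread` reaches all tableaux over a good
-- `p`.
Pair≈ : ℕ → Box → Path → Set
Pair≈ n p u = ∃ λ v → Pt n v × v ↭ u × u ≁ v × p ∷ u ≈[ suc n ] p ∷ v

-- Conjugating by tₙ the cycle through p ∷ z and taking the commutator with the cycle through q ∷ z:
-- the supports can only meet over z, where they meet in s ∷ q ∷ z alone.
module Step {m : ℕ} (full : Full (suc m)) (m≥2 : 2 ≤ m) {κ : Path} (five : Five m κ) (11∈κ : (1 , 1) ∈ κ)
  {p q : Box} (vp : Valid (p ∷ κ)) (vq : Valid (q ∷ κ)) where

  open Five five

  z : Path
  z = member 0F

  -- For two corners, `s` is `p` and `s′` is `q`. For a single corner, `p` and `q` are the box next
  -- to it, and `s` and `s′` are both the corner.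
  module _ {s s′ : Box} (pA : Pt (suc (suc m)) (s ∷ q ∷ z)) (tA : t (suc m) (s ∷ q ∷ z) ≡ s′ ∷ p ∷ z)
    (unique : ∀ s₁ s₂ → Pt (suc (suc m)) (s₁ ∷ q ∷ z) → t (suc m) (s₁ ∷ q ∷ z) ≡ s₂ ∷ p ∷ z → s₁ ≡ s) where

    private
      n : ℕ
      n = suc m

      A : Path
      A = s ∷ q ∷ z

      cycle : ∀ {b i j} → Valid (b ∷ κ) → 0F ≢ i → i ≢ j → 0F ≢ j →
        Tri n (b ∷ z) (b ∷ member i) (b ∷ member j)
      cycle {b} {i} {j} v 0≢i i≢j 0≢j =
          ≈⇒Tri (≈-trans (con 0F) (≈-sym (con i))) (≈-trans (con i) (≈-sym (con j)))
                (B.distinct 0≢i) (B.distinct i≢j) (B.distinct 0≢j)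
        where
        module B = Five (Five-∷ v five)
        con : ∀ i → b ∷ member i ≈[ n ] b ∷ κ
        con i = full (v , cong suc (trans (sym (↭-length (shape 0F))) (proj₂ (pt 0F)))) (there 11∈κ) (B.pt i) (B.shape i)

      γ : Tri n (p ∷ z) (p ∷ member 1F) (p ∷ member 2F)
      γ = cycle vp (λ ()) (λ ()) (λ ())

      η : Tri n (q ∷ z) (q ∷ member 3F) (q ∷ member 4F)
      η = cycle vq (λ ()) (λ ()) (λ ())

      g h f : List ℕ
      g = Tri.word γ
      h = Tri.word η
      f = n ∷ g ++ n ∷ []

      n-ok : Word (suc n) (n ∷ [])
      n-ok = (s≤s z≤n , n<1+n n) ∷ []

      f-ok : Word (suc n) f
      f-ok = Word-++ n-ok (Word-++ (Word-suc (Tri.word-ok γ)) n-ok)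

      act-f : ∀ x → act f x ≡ t n (act g (t n x))
      act-f x = cong (t n) (act-++ g (n ∷ []) x)

      act-over : ∀ {w b u} → Word n w → length u ≡ n → act w (b ∷ u) ≡ b ∷ act w u
      act-over {w} {b} {u} ok e = act-∷ {w} {b} {u} (subst (λ k → Word k w) (sym e) ok)

      len-q : length (q ∷ z) ≡ n
      len-q = suc-injective (proj₂ pA)

      hA : act h A ≡ s ∷ act h (q ∷ z)
      hA = act-over (Tri.word-ok η) len-q

      g-tA : act g (s′ ∷ p ∷ z) ≡ s′ ∷ act g (p ∷ z)
      g-tA = act-over (Tri.word-ok γ) len-q

      hA≁A : act h A ≁ A
      hA≁A e = Tri.a≁b η (~-trans (~-sym (~-tail (subst (_~ A) hA e))) (Tri.a→b η))

      g-moves : act g (s′ ∷ p ∷ z) ≁ s′ ∷ p ∷ z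
      g-moves e = Tri.a≁b γ (~-trans (~-sym (~-tail (subst (_~ _) g-tA e))) (Tri.a→b γ))

      t-fA : t n (act f A) ≡ act g (s′ ∷ p ∷ z)
      t-fA = trans (cong (t n) (act-f A)) (trans (t-involutive n _) (cong (act g) tA))

      fA≁A : act f A ≁ A
      fA≁A e = g-moves (subst₂ _~_ t-fA tA (~-act (n ∷ []) e))

      -- The two equivalences are of the same kind: an equality and a transposition together would
      -- give `z ≡ flip z`, against `flip-≢`. Two transpositions become two equalities under `flip`,
      -- which commutes with tₙ.
      meet-over-z : ∀ {b c b′ c′ v} → Pt (suc n) (b ∷ c ∷ v) → t n (b ∷ c ∷ v) ≡ b′ ∷ c′ ∷ v →
        c ∷ v ~ q ∷ z → c′ ∷ v ~ p ∷ z → b ∷ c ∷ v ~ A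
      meet-over-z px tx (inj₁ refl) (inj₁ refl) = inj₁ (cong (_∷ _) (unique _ _ px tx))
      meet-over-z {b} px tx (inj₂ refl) (inj₂ refl) = inj₂ (cong₂ _∷_ (cong swap
          (unique (swap b) _ (subst (Pt _) (cong (λ u → swap b ∷ q ∷ u) (flip-flip z)) (Pt-~ (inj₂ refl) px))
            (trans (cong (λ u → t n (swap b ∷ q ∷ u)) (sym (flip-flip z)))
            (trans (t-flip n (b ∷ flip (q ∷ z))) (trans (cong flip tx) (cong (λ u → _ ∷ p ∷ u) (flip-flip z))))))) refl)
      meet-over-z _ _ (inj₁ e) (inj₂ e′) =
        contradiction (trans (sym (∷-injectiveʳ e′)) (∷-injectiveʳ e)) (flip-≢ (proj₁ (pt 0F)) (subst (2 ≤_) (sym (proj₂ (pt 0F))) m≥2))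
      meet-over-z _ _ (inj₂ e) (inj₁ e′) =
        contradiction (trans (sym (∷-injectiveʳ e)) (∷-injectiveʳ e′)) (flip-≢ (proj₁ (pt 0F)) (subst (2 ≤_) (sym (proj₂ (pt 0F))) m≥2))

      -- tₙ does not change the part `v` below the top two boxes, so the supports cannot meet over
      -- different members.
      clash : ∀ {X : Set} {c c′ d d′ v i j} → i ≢ j → c ∷ v ~ d ∷ member i → c′ ∷ v ~ d′ ∷ member j → X
      clash i≢j e e′ = ⊥-elim (distinct i≢j (~-trans (~-sym (~-tail e)) (~-tail e′)))

      meet : ∀ {x} → Pt (suc n) x → act f x ≡ x ⊎ act h x ≡ x ⊎ x ~ A
      meet {b ∷ c ∷ v} px with act f (b ∷ c ∷ v) ≟ᴾ (b ∷ c ∷ v) | act h (b ∷ c ∷ v) ≟ᴾ (b ∷ c ∷ v)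
      ... | yes e | _ = inj₁ e
      ... | no _ | yes e = inj₂ (inj₁ e)
      ... | no f-moves | no h-moves with top-tails b c v
      ... | b′ , c′ , top-eq = inj₂ (inj₂ (combine (Tri-moved η pu h-moves′) (Tri-moved γ pu′ g-moves′)))
        where
        pu : Pt n (c ∷ v)
        pu = Pt-tail px
        tx : t n (b ∷ c ∷ v) ≡ b′ ∷ c′ ∷ v
        tx = trans (t-top b (c ∷ v) (proj₂ pu)) top-eq
        pu′ : Pt n (c′ ∷ v)
        pu′ = Pt-tail (subst (Pt (suc n)) tx (Pt-act (n ∷ []) px))
        h-moves′ : act h (c ∷ v) ≢ c ∷ v
        h-moves′ e = h-moves (trans (act-over (Tri.word-ok η) (proj₂ pu)) (cong (b ∷_) e))
        g-moves′ : act g (c′ ∷ v) ≢ c′ ∷ v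
        g-moves′ e = f-moves (trans (act-f _) (trans (cong (t n) (trans (cong (act g) tx)
          (trans (act-over (Tri.word-ok γ) (proj₂ pu′)) (trans (cong (b′ ∷_) e) (sym tx))))) (t-involutive n _)))
        combine : c ∷ v ~ q ∷ z ⊎ c ∷ v ~ q ∷ member 3F ⊎ c ∷ v ~ q ∷ member 4F →
                  c′ ∷ v ~ p ∷ z ⊎ c′ ∷ v ~ p ∷ member 1F ⊎ c′ ∷ v ~ p ∷ member 2F → b ∷ c ∷ v ~ A
        combine (inj₁ e) (inj₁ e′) = meet-over-z px tx e e′
        combine (inj₁ e) (inj₂ (inj₁ e′)) = clash {i = 0F} {j = 1F} (λ ()) e e′
        combine (inj₁ e) (inj₂ (inj₂ e′)) = clash {i = 0F} {j = 2F} (λ ()) e e′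
        combine (inj₂ (inj₁ e)) (inj₁ e′) = clash {i = 3F} {j = 0F} (λ ()) e e′
        combine (inj₂ (inj₁ e)) (inj₂ (inj₁ e′)) = clash {i = 3F} {j = 1F} (λ ()) e e′
        combine (inj₂ (inj₁ e)) (inj₂ (inj₂ e′)) = clash {i = 3F} {j = 2F} (λ ()) e e′
        combine (inj₂ (inj₂ e)) (inj₁ e′) = clash {i = 4F} {j = 0F} (λ ()) e e′
        combine (inj₂ (inj₂ e)) (inj₂ (inj₁ e′)) = clash {i = 4F} {j = 1F} (λ ()) e e′
        combine (inj₂ (inj₂ e)) (inj₂ (inj₂ e′)) = clash {i = 4F} {j = 2F} (λ ()) e e′

      commutator : Tri (suc n) A (act f A) (act h A)
      commutator = commutator-Tri f h f-ok (Word-suc (Tri.word-ok η)) pA fA≁A hA≁A meet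

    -- Of the points of the commutator, `A` and `act h A` lie over `s`. The pair over `s′` comes
    -- from `A` and `act f A`, which tₙ takes there.
    pairˢ : Pair≈ n s (q ∷ z)
    pairˢ = act h (q ∷ z) , Pt-act h (Pt-tail pA) , act-↭ h (q ∷ z)
      , (λ e → Tri.a≁b η (~-trans e (Tri.a→b η)))
      , subst (A ≈[ suc n ]_) hA (inj₂ (_ , Tri-reverse commutator))

    pairˢ′ : Pair≈ n s′ (p ∷ z)
    pairˢ′ = act g (p ∷ z) , Pt-act g (Pt-tail (subst (Pt (suc n)) tA (Pt-act (n ∷ []) pA))) , act-↭ g (p ∷ z)
      , (λ e → Tri.a≁b γ (~-trans e (Tri.a→b γ)))
      , subst₂ (_≈[ suc n ]_) tA (trans t-fA g-tA) (≈-act (n ∷ []) n-ok (inj₂ (_ , commutator)))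

-- The inductive step

grid : Box → List Box
grid (i , j) = cartesianProduct (upTo (suc i)) (upTo (suc j))

∈-grid : ∀ {b c} → b ≼ c → b ∈ grid c
∈-grid (p , q) = ∈-cartesianProduct⁺ (∈-upTo⁺ (s≤s p)) (∈-upTo⁺ (s≤s q))

-- By `corner-above`, a box that escapes lies under a corner different from `P` and `Q`. If none
-- does, the shape is nearly determined by `P` and `Q`.
escape : ∀ x (P Q : Box) → (∃ λ b → b ∈ x × ¬ b ≼ P × ¬ b ≼ Q) ⊎ (∀ {b} → b ∈ x → b ≼ P ⊎ b ≼ Q)
escape x P Q with any? (λ b → ¬? (b ≼? P) ×-dec ¬? (b ≼? Q)) x
... | yes a with find a
... | b , b∈ , esc = inj₁ (b , b∈ , esc)
escape x P Q | no ¬a = inj₂ bounded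
  where
  bounded : ∀ {b} → b ∈ x → b ≼ P ⊎ b ≼ Q
  bounded {b} b∈ with b ≼? P | b ≼? Q
  ... | yes p | _ = inj₁ p
  ... | no _ | yes q = inj₂ q
  ... | no ¬p | no ¬q = contradiction (lose b∈ (¬p , ¬q)) ¬a

too-long : ∀ {x ys} k → Valid x → k < length x → x ⊆ ys → length ys ≤ k → ⊥
too-long k v k< sub len = 1+n≰n (≤-trans k< (≤-trans (Unique-⊆-length (Valid-unique v) sub) len))

SelfTOff : Box → Path → Set
SelfTOff p x = ∀ {b} → b ∈ x → b ≢ p → swap b ∈ x × swap b ≢ p

selfTOff? : ∀ p x → Dec (SelfTOff p x)
selfTOff? p x with All.all? (λ b → (b ≟ᴮ p) ⊎-dec ((swap b ∈? x) ×-dec ¬? (swap b ≟ᴮ p))) x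
... | yes a = yes λ b∈ b≢ → [ (λ e → contradiction e b≢) , id ]′ (All.lookup a b∈)
... | no ¬a = no λ s → ¬a (All.tabulate λ {b} b∈ → case b ≟ᴮ p of λ where
        (yes e) → inj₁ e
        (no ne) → inj₂ (s b∈ ne))

GoodIn : Box → Path → Set
GoodIn p x = swap p ≡ p ⊎ ¬ SelfTOff p x

BadIn : Box → Path → Set
BadIn p x = swap p ≢ p × SelfTOff p x

good⊎bad : ∀ p x → GoodIn p x ⊎ BadIn p x
good⊎bad p x with swap p ≟ᴮ p | selfTOff? p x
... | yes e | _ = inj₁ (inj₁ e)
... | no ne | yes s = inj₂ (ne , s)
... | no _ | no ¬s = inj₁ (inj₂ ¬s)

off-head : ∀ {p b : Box} {r} → b ≢ p → b ∈ p ∷ r → b ∈ r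
off-head b≢ (here e)  = contradiction e b≢
off-head b≢ (there q) = q

GoodIn⇒Good : ∀ {p x r} → Valid (p ∷ r) → x ↭ p ∷ r → GoodIn p x → Good p r
GoodIn⇒Good _ _ (inj₁ e) = inj₁ e
GoodIn⇒Good {p} {x} {r} ((p∉ , _) ∷ _) e (inj₂ ¬s) = inj₂ λ s → ¬s λ b∈ b≢ →
  let sb∈ = s (off-head b≢ (∈-resp-↭ e b∈)) in
  ∈-resp-↭ (↭-sym e) (there sb∈) , λ eq → p∉ (subst (_∈ r) eq sb∈)

-- `x` without `d` contains `e`, hence `swap e`. Since `e` is off the diagonal, `swap e` also lies
-- in `x` without `e`, and then so would `e`.
bad-unique : ∀ {d e x} → d ≢ e → e ∈ x → BadIn d x → BadIn e x → ⊥
bad-unique d≢e e∈ (_ , sd) (ne , se) = proj₂ (se (proj₁ (sd e∈ (d≢e ∘ sym))) ne) refl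

-- A shape x with x ∖ e self-transpose and no corner besides e, q and possibly (1 , 1) in x ∖ q:
-- the only ones are (3,2,2), (4,2,1) and their transposes, which have seven boxes.
bad-bound-row : ∀ {x i j q} → Valid x → 7 < length x → (i , j) ∈ x → q ∈ x →
  SelfTOff (i , j) x → (∀ {b} → b ∈ x → b ≢ q → b ≼ (i , j) ⊎ b ≼ (1 , 1)) →
  i ≡ 0 ⊎ (∃ λ i′ → i ≡ suc i′ × ∃ λ j′ → j ≡ suc j′ × q ≡ (0 , suc j)) → ⊥
bad-bound-row {x} {i} {j} {q} v long e∈ q∈ s bound (inj₁ refl) = too-long 7 v long sub ≤-refl
  where
  -- Transposing (0 , j - 1) gives (j - 1 , 0). This box, or the one above it in case it is `q`,
  -- lies in row 0 or 1, so j - 1 ≤ 2.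
  j≤3 : ∀ j → (0 , j) ∈ x → SelfTOff (0 , j) x → (∀ {b} → b ∈ x → b ≢ q → b ≼ (0 , j) ⊎ b ≼ (1 , 1)) → j ≤ 3
  j≤3 zero _ _ _ = z≤n
  j≤3 (suc zero) _ _ _ = s≤s z≤n
  j≤3 (suc (suc k)) e∈ s bound = s≤s (s≤s (bounded (suc k , 0) sw refl))
    where
    sw : (suc k , 0) ∈ x
    sw = proj₁ (s (Valid-closed v e∈ (inj₁ refl)) (λ ()))
    bounded : ∀ b → b ∈ x → b ≡ (suc k , 0) → k ≤ 1
    bounded b b∈ eq with b ≟ᴮ q
    bounded b b∈ eq | no ne with bound b∈ ne
    bounded b b∈ refl | no ne | inj₁ (() , _)
    bounded b b∈ refl | no ne | inj₂ (s≤s p , _) = ≤-trans p z≤n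
    bounded b b∈ refl | yes refl with bound (Valid-closed v b∈ (inj₂ refl)) (λ ())
    ... | inj₁ (p , _) = ≤-trans p z≤n
    ... | inj₂ (p , _) = p
  sub : x ⊆ q ∷ (1 , 0) ∷ (1 , 1) ∷ grid (0 , 3)
  sub {b} b∈ with b ≟ᴮ q
  ... | yes eq = here eq
  ... | no ne with bound b∈ ne
  ... | inj₁ (p , p′) = there (there (there (∈-grid (p , ≤-trans p′ (j≤3 j e∈ s bound)))))
  sub {zero , l} b∈ | no ne | inj₂ (_ , p′) = there (there (there (∈-grid {c = 0 , 3} (z≤n , ≤-trans p′ (s≤s z≤n)))))
  sub {suc zero , zero} b∈ | no ne | inj₂ _ = there (here refl)
  sub {suc zero , suc zero} b∈ | no ne | inj₂ _ = there (there (here refl))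
  sub {suc zero , suc (suc l)} b∈ | no ne | inj₂ (_ , s≤s ())
  sub {suc (suc k) , l} b∈ | no ne | inj₂ (s≤s () , _)
bad-bound-row {x} {i} {j} {q} v long e∈ q∈ s bound (inj₂ (i′ , refl , j′ , refl , refl)) = absurd j′ i′ refl refl
  where
  within : ∀ {b} → b ∈ x → b ≢ (0 , suc (suc j′)) → b ≼ (suc i′ , suc j′)
  within b∈ ne with bound b∈ ne
  ... | inj₁ p = p
  ... | inj₂ (p , p′) = ≤-trans p (s≤s z≤n) , ≤-trans p′ (s≤s z≤n)
  j<i : suc j′ ≤ i′
  j<i = ≤-pred (proj₁ (within (proj₁ (s q∈ (λ ()))) (λ ())))
  0i∈ : (0 , suc i′) ∈ x
  0i∈ = proj₁ (s (Valid-closed-≼ v e∈ (≤-refl , z≤n)) (λ ()))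
  i≤j : i′ ≤ suc j′
  i≤j with (0 , suc i′) ≟ᴮ (0 , suc (suc j′))
  ... | yes refl = ≤-refl
  ... | no ne = ≤-pred (≤-trans (proj₂ (within 0i∈ ne)) (n≤1+n _))
  i≡ : i′ ≡ suc j′
  i≡ = ≤-antisym i≤j j<i
  -- By now `e` is (j′ + 2 , j′ + 1) and `q` is (0 , j′ + 2). For j′ = 0 the shape is (3,2,2).
  -- Otherwise (j′ + 2 , 1) differs from `e`, and its transpose (1 , j′ + 2) is not under `e`.
  absurd : ∀ a b → a ≡ j′ → b ≡ i′ → ⊥
  absurd zero b refl refl with i≡
  ... | refl = too-long 7 v long sub ≤-refl
    where
    sub : x ⊆ (0 , 2) ∷ grid (2 , 1)
    sub {b} b∈ with b ≟ᴮ (0 , 2)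
    ... | yes eq = here eq
    ... | no ne  = there (∈-grid (within b∈ ne))
  absurd (suc a) b refl refl with i≡
  ... | refl = 1+n≰n (proj₂ (within (proj₁ (s (Valid-closed-≼ v e∈ (≤-refl , s≤s z≤n)) (λ ()))) (λ ())))

-- Let `e` be outside the first row and column. Then `q` sticks out by one box along the first row
-- or column: otherwise the boxes above and to the left of `q` would both be under `e`, and so would
-- `q`. The column case is the row case of `flip x`.
bad-bound : ∀ {x e q} → Valid x → 7 < length x → e ∈ x → q ∈ x → Corner q x → q ≢ e → SelfTOff e x →
  (∀ {b} → b ∈ x → b ≢ q → b ≼ e ⊎ b ≼ (1 , 1)) → ⊥
bad-bound {x} {zero , j} v long e∈ q∈ co ne s bound = bad-bound-row v long e∈ q∈ s bound (inj₁ refl)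
bad-bound {x} {suc i , j} {q} v long e∈ q∈ co ne s bound = go j refl q refl
  where
  s′ : SelfTOff (swap (suc i , j)) (flip x)
  s′ {b} b∈ b≢ with s (∈-unflip b∈) (b≢ ∘ cong swap)
  ... | m , m≢ = ∈-flip m , m≢ ∘ cong swap
  bound′ : ∀ {b} → b ∈ flip x → b ≢ swap q → b ≼ swap (suc i , j) ⊎ b ≼ (1 , 1)
  bound′ b∈ b≢ with bound (∈-unflip b∈) (b≢ ∘ cong swap)
  ... | inj₁ (p , p′) = inj₁ (p′ , p)
  ... | inj₂ (p , p′) = inj₂ (p′ , p)
  flipped : j ≡ 0 ⊎ (∃ λ i′ → j ≡ suc i′ × ∃ λ j′ → suc i ≡ suc j′ × swap q ≡ (0 , suc (suc i))) → ⊥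
  flipped = bad-bound-row (Valid-flip v) (subst (7 <_) (sym (length-map swap x)) long) (∈-flip e∈) (∈-flip q∈) s′ bound′
  go : ∀ j′ → j′ ≡ j → ∀ q′ → q′ ≡ q → ⊥
  go zero refl _ _ = flipped (inj₁ refl)
  go (suc j) refl (zero , l) refl = bad-bound-row v long e∈ q∈ s bound (inj₂ (i , refl , j , refl , cong (0 ,_) (l≡ l refl)))
    where
    l≡ : ∀ l′ → l′ ≡ l → l′ ≡ suc (suc j)
    l≡ zero refl = contradiction (sym (Corner-≼ v co e∈ (z≤n , z≤n))) ne
    l≡ (suc l) refl with l ≤? j
    ... | yes l≤ = contradiction (sym (Corner-≼ v co e∈ (z≤n , s≤s l≤))) ne
    ... | no l≰ with bound (Valid-closed v q∈ (inj₁ refl)) (λ ())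
    ... | inj₁ (_ , p) = cong suc (≤-antisym p (≰⇒> l≰))
    ... | inj₂ (_ , p) = cong suc (≤-antisym (≤-trans p (s≤s z≤n)) (≰⇒> l≰))
  go (suc j) refl (suc k , zero) refl = flipped (inj₂ (j , refl , i , refl , cong (λ a → 0 , a) k≡))
    where
    k≡ : suc k ≡ suc (suc i)
    k≡ with k ≤? i
    ... | yes k≤ = contradiction (sym (Corner-≼ v co e∈ (s≤s k≤ , z≤n))) ne
    ... | no k≰ with bound (Valid-closed v q∈ (inj₂ refl)) (λ ())
    ... | inj₁ (p , _) = cong suc (≤-antisym p (≰⇒> k≰))
    ... | inj₂ (p , _) = cong suc (≤-antisym (≤-trans p (s≤s z≤n)) (≰⇒> k≰))
  go (suc j) refl (suc k , suc l) refl = contradiction (sym (Corner-≼ v co e∈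
      (proj₁ (within (bound (Valid-closed v q∈ (inj₁ refl)) (λ ())))
      , proj₂ (within (bound (Valid-closed v q∈ (inj₂ refl)) (λ ())))))) ne
    where
    within : ∀ {b} → b ≼ (suc i , suc j) ⊎ b ≼ (1 , 1) → b ≼ (suc i , suc j)
    within (inj₁ p) = p
    within (inj₂ (p , p′)) = ≤-trans p (s≤s z≤n) , ≤-trans p′ (s≤s z≤n)

module Induction {m : ℕ} (m≥6 : 6 ≤ m) (full : Full (suc m))
  (fives : ∀ {κ} → Pt m κ → (1 , 1) ∈ κ → Five m κ) where

  private
    n : ℕ
    n = suc m

    m≥2 : 2 ≤ m
    m≥2 = ≤-trans (s≤s (s≤s z≤n)) m≥6

    t-apart : ∀ {p q z} → length z ≡ m → ¬ Touch p q → t n (p ∷ q ∷ z) ≡ q ∷ p ∷ z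
    t-apart {p} {q} {z} len apart = trans (t-top p (q ∷ z) (cong suc len)) (top-apart apart)

    t-touch : ∀ {p q z} → length z ≡ m → Touch p q → t n (p ∷ q ∷ z) ≡ p ∷ q ∷ z
    t-touch {p} {q} {z} len touch = trans (t-top p (q ∷ z) (cong suc len)) (top-touch touch)

    n-ok : Word (suc n) (n ∷ [])
    n-ok = (s≤s z≤n , n<1+n n) ∷ []

  Over : Box → Path → Set
  Over p u = ∀ {y} → Pt n y → y ↭ u → p ∷ y ≈[ suc n ] p ∷ u

  Pair≈⇒Over : ∀ {p u} → Pt (suc n) (p ∷ u) → (1 , 1) ∈ u → Good p u → Pair≈ n p u → Over p u
  Pair≈⇒Over pu 11∈ good (v , pv , v↭ , u≁v , u≈v) = spread full 11∈ pu pv v↭ u≁v good u≈v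

  -- tₙ fixes a tableau `p ∷ r ∷ s`, and `Over p u` takes care of the other generators.
  touching⇒Connected : ∀ {p u r} → Pt (suc n) (p ∷ u) → Over p u → r ∈ u → Corner r u → Touch p r →
    Connected (suc n) (p ∷ u)
  touching⇒Connected {p} {u} {r} pu@(_ ∷ v , len) over r∈ co touch with pull v r∈ co
  ... | s , vs , u↭ = over⇒Connected pu over (vs , len-s) (↭-sym u↭)
          (inj₁ (inj₁ (t-touch (suc-injective len-s) touch)))
    where
    len-s : length (r ∷ s) ≡ n
    len-s = trans (sym (↭-length u↭)) (suc-injective len)

  record TwoCorners (x : Path) (p q : Box) : Set where
    field
      rest   : Path
      pt     : Pt (suc n) (p ∷ q ∷ rest)
      shape  : x ↭ p ∷ q ∷ rest
      apart  : ¬ Touch p q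
      11∈    : (1 , 1) ∈ rest
      pairᵖ  : Pair≈ n p (q ∷ rest)
      pairᑫ  : Pair≈ n q (p ∷ rest)

    ptᑫ : Pt (suc n) (q ∷ p ∷ rest)
    ptᑫ = Valid-exchange (proj₁ pt) apart , proj₂ pt

    overᵖ : GoodIn p x → Over p (q ∷ rest)
    overᵖ good = Pair≈⇒Over pt (there 11∈) (GoodIn⇒Good (proj₁ pt) shape good) pairᵖ

    overᑫ : GoodIn q x → Over q (p ∷ rest)
    overᑫ good = Pair≈⇒Over ptᑫ (there 11∈)
      (GoodIn⇒Good (proj₁ ptᑫ) (↭-trans shape (↭-swap p q ↭-refl)) good) pairᑫ

  two-corners : ∀ {x p q} → Pt (suc n) x → (1 , 1) ∈ x → p ∈ x → Corner p x → q ∈ x → Corner q x →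
    p ≢ q → (1 , 1) ≢ p → (1 , 1) ≢ q → TwoCorners x p q
  two-corners {x} {p} {q} (v , len) 11∈x p∈ cp q∈ cq p≢q p≢11 q≢11 with pull v p∈ cp
  ... | r , V@(_ ∷ vr) , x↭ with pull vr (off-head (p≢q ∘ sym) (∈-resp-↭ x↭ q∈))
                                (λ c e → Corner-↭ x↭ cq c (there e))
  ... | κ , vqκ , r↭ = record
    { rest = z ; pt = pA ; shape = shape′ ; apart = apart ; 11∈ = ∈-resp-↭ (↭-sym (F.shape 0F)) 11∈κ
    ; pairᵖ = S.pairˢ pA tA unique ; pairᑫ = S.pairˢ′ pA tA unique }
    where
    V′ : Valid (p ∷ q ∷ κ)
    V′ = Valid-∷-↭ V vqκ (↭-sym r↭)
    x↭′ : x ↭ p ∷ q ∷ κ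
    x↭′ = ↭-trans x↭ (↭-prep p r↭)
    apart : ¬ Touch p q
    apart = heads-apart V′ (Corner-↭ x↭′ cq)
    len-κ : length κ ≡ m
    len-κ = suc-injective (suc-injective (trans (sym (↭-length x↭′)) len))
    11∈κ : (1 , 1) ∈ κ
    11∈κ = off-head q≢11 (off-head p≢11 (∈-resp-↭ x↭′ 11∈x))
    five : Five m κ
    five = fives (Valid-tail vqκ , len-κ) 11∈κ
    vpκ : Valid (p ∷ κ)
    vpκ = Valid-tail (Valid-exchange V′ apart)
    module F = Five five
    module S = Step full m≥2 five 11∈κ vpκ vqκ
    z : Path
    z = F.member 0F
    len-z : length z ≡ m
    len-z = proj₂ (F.pt 0F)
    pA : Pt (suc n) (p ∷ q ∷ z)
    pA = Valid-∷-↭ V′ (Valid-∷-↭ vqκ (proj₁ (F.pt 0F)) (F.shape 0F)) (↭-prep q (F.shape 0F)) , cong (suc ∘ suc) len-z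
    shape′ : x ↭ p ∷ q ∷ z
    shape′ = ↭-trans x↭′ (↭-prep p (↭-prep q (↭-sym (F.shape 0F))))
    tA : t n (p ∷ q ∷ z) ≡ q ∷ p ∷ z
    tA = t-apart len-z apart
    unique : ∀ s₁ s₂ → Pt (suc n) (s₁ ∷ q ∷ z) → t n (s₁ ∷ q ∷ z) ≡ s₂ ∷ p ∷ z → s₁ ≡ p
    unique s₁ s₂ _ e with touch? s₁ q
    ... | yes tc = contradiction (sym (∷-injectiveˡ (∷-injectiveʳ (trans (sym (t-touch {z = z} len-z tc)) e)))) p≢q
    ... | no ¬tc = ∷-injectiveˡ (∷-injectiveʳ (trans (sym (t-apart {z = z} len-z ¬tc)) e))

  -- The tableaux over r link tₙ of the block over p with the block over q, and conversely;
  -- the generators below n act transitively on them.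
  third⇒≈ : ∀ {p q z r} → Pt (suc n) (p ∷ q ∷ z) → ¬ Touch p q → Over p (q ∷ z) → Over q (p ∷ z) →
    r ∈ z → Corner r (p ∷ q ∷ z) → q ∷ p ∷ z ≈[ suc n ] p ∷ q ∷ z
  third⇒≈ {p} {q} {z} {r} pt@(V , len) apart overᵖ overᑫ r∈ co =
    -- The chain leads from `p ∷ q ∷ z` by `link₂` to `r ∷ q ∷ Q.s`, which is `act w (r ∷ p ∷ P.s)`,
    -- from there by `link₁` to `act w (q ∷ p ∷ z)`, and by `overᑫ` to `q ∷ p ∷ z`.
    ≈-sym (≈-trans (≈-sym link₂)
      (subst₂ (_≈[ suc n ]_) moved refl (≈-trans (≈-act w (Word-suc w-ok) link₁)
        (subst (_≈[ suc n ] _) (sym (act-∷ (subst (λ k → Word k w) (sym (suc-injective len)) w-ok)))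
          (overᑫ (Pt-act w (Pt-tail ptᑫ)) (act-↭ w (p ∷ z)))))))
    where
    len-z : length z ≡ m
    len-z = suc-injective (suc-injective len)
    V′ : Valid (q ∷ p ∷ z)
    V′ = Valid-exchange V apart
    ptᑫ : Pt (suc n) (q ∷ p ∷ z)
    ptᑫ = V′ , len
    co′ : Corner r (q ∷ p ∷ z)
    co′ = Corner-↭ (↭-swap p q ↭-refl) co
    record Exposed (a : Box) (u : Path) : Set where
      field
        s     : Path
        pt-rs : Pt n (r ∷ s)
        shape : r ∷ s ↭ u
        t-eq  : t n (a ∷ r ∷ s) ≡ r ∷ a ∷ s
        pt-as : Pt n (a ∷ s)
    expose : ∀ {a u} → Valid (a ∷ u) → length u ≡ n → r ∈ u → Corner r (a ∷ u) → Exposed a u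
    expose {a} {u} va len-u r∈u co-a with pull (Valid-tail va) r∈u (λ c e → co-a c (there e))
    ... | s , vs , u↭ = record
      { s = s ; pt-rs = vs , len-rs ; shape = ↭-sym u↭ ; t-eq = t-apart (suc-injective len-rs) ap
      ; pt-as = Valid-tail (Valid-exchange va′ ap) , len-rs }
      where
      len-rs : length (r ∷ s) ≡ n
      len-rs = trans (sym (↭-length u↭)) len-u
      va′ : Valid (a ∷ r ∷ s)
      va′ = Valid-∷-↭ va vs (↭-sym u↭)
      ap : ¬ Touch a r
      ap = heads-apart va′ (Corner-↭ (↭-prep a u↭) co-a)
    module P = Exposed (expose V (suc-injective len) (there r∈) co)
    module Q = Exposed (expose V′ (suc-injective len) (there r∈) co′)
    link₁ : r ∷ p ∷ P.s ≈[ suc n ] q ∷ p ∷ z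
    link₁ = subst₂ (_≈[ suc n ]_) P.t-eq (t-apart len-z apart) (≈-act (n ∷ []) n-ok (overᵖ P.pt-rs P.shape))
    link₂ : r ∷ q ∷ Q.s ≈[ suc n ] p ∷ q ∷ z
    link₂ = subst₂ (_≈[ suc n ]_) Q.t-eq (t-apart len-z (apart ∘ Touch-sym)) (≈-act (n ∷ []) n-ok (overᑫ Q.pt-rs Q.shape))
    ps₁↭qs₂ : p ∷ P.s ↭ q ∷ Q.s
    ps₁↭qs₂ = drop-∷ {x = r} (↭-trans (↭-swap r p ↭-refl) (↭-trans (↭-prep p P.shape)
      (↭-trans (↭-swap p q ↭-refl) (↭-trans (↭-prep q (↭-sym Q.shape)) (↭-swap q r ↭-refl)))))
    connect : ∃ λ w → Word n w × act w (p ∷ P.s) ≡ q ∷ Q.s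
    connect = transitive n P.pt-as (proj₁ Q.pt-as) ps₁↭qs₂
    w : List ℕ
    w = proj₁ connect
    w-ok : Word n w
    w-ok = proj₁ (proj₂ connect)
    moved : act w (r ∷ p ∷ P.s) ≡ r ∷ q ∷ Q.s
    moved = trans (act-∷ (subst (λ k → Word k w) (sym (proj₂ P.pt-as)) w-ok)) (cong (r ∷_) (proj₂ (proj₂ connect)))

  private
    -- If `r` touches `p`, some tableau over `p` is fixed by tₙ. If not, `r` remains a corner after
    -- `p` is added and serves as the third one.
    extra⇒Connected : ∀ {p q z r} → Pt (suc n) (p ∷ q ∷ z) → ¬ Touch p q → Over p (q ∷ z) → Over q (p ∷ z) →
      r ∈ q ∷ z → Corner r (q ∷ z) → r ≢ q → Connected (suc n) (p ∷ q ∷ z)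
    extra⇒Connected {p} {q} {z} {r} pt apart overᵖ overᑫ r∈ co r≢q with touch? p r
    ... | yes tc = touching⇒Connected pt overᵖ r∈ co tc
    ... | no ¬tc = over⇒Connected pt overᵖ (Pt-tail pt) ↭-refl
        (subst (_≈[ suc n ] p ∷ q ∷ z) (sym (t-apart (suc-injective (suc-injective (proj₂ pt))) apart))
          (third⇒≈ pt apart overᵖ overᑫ (off-head r≢q r∈) co′))
      where
      co′ : Corner r (p ∷ q ∷ z)
      co′ c (here refl) = ¬tc (inj₂ c)
      co′ c (there e)   = co c e

    -- If `q` is in the first row or column, (1 , 1) lies under a corner other than `q`. Otherwise
    -- one of the boxes above and to the left of `q` is not under `p`, since `q` is not; a corner
    -- dominating it is there once `q` is removed.
    extra-corner : ∀ {p q z} → Valid (p ∷ q ∷ z) → ¬ Touch p q → (1 , 1) ∈ z →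
      (∃ λ r → r ∈ q ∷ z × Corner r (q ∷ z) × r ≢ q) ⊎ (∃ λ r → r ∈ p ∷ z × Corner r (p ∷ z) × r ≢ p)
    extra-corner {p} {zero , j} {z} V apart 11∈ with corner-above (Valid-tail V) (there 11∈)
    ... | r , r∈ , (s≤s _ , _) , co = inj₁ (r , r∈ , co , λ ())
    extra-corner {p} {suc i , zero} {z} V apart 11∈ with corner-above (Valid-tail V) (there 11∈)
    ... | r , r∈ , (_ , s≤s _) , co = inj₁ (r , r∈ , co , λ ())
    extra-corner {p} {suc i , suc j} {z} V@((p∉ , _) ∷ (q∉ , clq) ∷ vz) apart 11∈ = search ((suc i , j) ≼? p) ((i , suc j) ≼? p)
      where
      V′ : Valid ((suc i , suc j) ∷ p ∷ z)
      V′ = Valid-exchange V apart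
      above : ∀ {b} → b ⋖ (suc i , suc j) → ¬ b ≼ p → ∃ λ r → r ∈ p ∷ z × Corner r (p ∷ z) × r ≢ p
      above b⋖ b⋠ with corner-above (Valid-tail V′) (there (clq b⋖))
      ... | r , r∈ , b≼ , co = r , r∈ , co , λ { refl → b⋠ b≼ }
      search : Dec ((suc i , j) ≼ p) → Dec ((i , suc j) ≼ p) → _
      search (no ⋠) _ = inj₂ (above (inj₁ refl) ⋠)
      search (yes _) (no ⋠) = inj₂ (above (inj₂ refl) ⋠)
      search (yes (a , _)) (yes (_ , b)) =
        contradiction (here (Corner-≼ V′ (Corner-head V′) (there (here refl)) (a , b))) p∉

  good-good : ∀ {x p q} → Pt (suc n) x → (1 , 1) ∈ x → p ∈ x → Corner p x → q ∈ x → Corner q x →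
    p ≢ q → (1 , 1) ≢ p → (1 , 1) ≢ q → GoodIn p x → GoodIn q x → Connected (suc n) x
  good-good {x} {p} {q} px 11∈x p∈ cp q∈ cq p≢q p≢11 q≢11 gp gq = finish (extra-corner (proj₁ pt) apart 11∈)
    where
    open TwoCorners (two-corners px 11∈x p∈ cp q∈ cq p≢q p≢11 q≢11)
    finish : (∃ λ r → r ∈ q ∷ rest × Corner r (q ∷ rest) × r ≢ q) ⊎ (∃ λ r → r ∈ p ∷ rest × Corner r (p ∷ rest) × r ≢ p) →
      Connected (suc n) x
    finish (inj₁ (r , r∈ , co , r≢)) = Connected-↭ px shape
      (extra⇒Connected pt apart (overᵖ gp) (overᑫ gq) r∈ co r≢)
    finish (inj₂ (r , r∈ , co , r≢)) = Connected-↭ px (↭-trans shape (↭-swap p q ↭-refl))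
      (extra⇒Connected ptᑫ (apart ∘ Touch-sym) (overᑫ gq) (overᵖ gp) r∈ co r≢)

  -- Only the tableaux over `q` can be spread. Take a corner of `x` without `q`, other than `e` and
  -- (1 , 1). If it touches `q`, tₙ fixes a tableau over `q`; if not, it is a corner of `x`, and
  -- good because `e` is the only bad one. `bad-bound` shows that such a corner exists.
  bad-good : ∀ {x e q} → Pt (suc n) x → (1 , 1) ∈ x → e ∈ x → Corner e x → q ∈ x → Corner q x →
    e ≢ q → (1 , 1) ≢ e → (1 , 1) ≢ q → BadIn e x → GoodIn q x → Connected (suc n) x
  bad-good {x} {e} {q} px@(v , len) 11∈x e∈ ce q∈ cq e≢q e≢11 q≢11 bad gq = finish (escape (e ∷ rest) e (1 , 1))
    where
    open TwoCorners (two-corners px 11∈x e∈ ce q∈ cq e≢q e≢11 q≢11)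
    x↭ : x ↭ q ∷ e ∷ rest
    x↭ = ↭-trans shape (↭-swap e q ↭-refl)
    finish : (∃ λ b → b ∈ e ∷ rest × ¬ b ≼ e × ¬ b ≼ (1 , 1)) ⊎ (∀ {b} → b ∈ e ∷ rest → b ≼ e ⊎ b ≼ (1 , 1)) →
      Connected (suc n) x
    finish (inj₂ bound) = ⊥-elim (bad-bound v (subst (7 <_) (sym len) (s≤s (s≤s m≥6))) e∈ q∈ cq (e≢q ∘ sym)
      (proj₂ bad) (λ b∈ b≢ → bound (off-head b≢ (∈-resp-↭ x↭ b∈))))
    finish (inj₁ (b , b∈ , b⋠e , b⋠11)) with corner-above (Valid-tail (proj₁ ptᑫ)) b∈
    ... | r , r∈ , b≼r , co with touch? q r
    ... | yes tc = Connected-↭ px x↭ (touching⇒Connected ptᑫ (overᑫ gq) r∈ co tc)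
    ... | no ¬tc = third (good⊎bad r x)
      where
      r∈x : r ∈ x
      r∈x = ∈-resp-↭ (↭-sym x↭) (there r∈)
      r≢e : r ≢ e
      r≢e refl = b⋠e b≼r
      co′ : Corner r x
      co′ c d∈ with ∈-resp-↭ x↭ d∈
      ... | here refl = ¬tc (inj₂ c)
      ... | there d∈′ = co c d∈′
      q≢r : q ≢ r
      q≢r refl with proj₁ ptᑫ
      ... | (q∉ , _) ∷ _ = q∉ r∈
      r≢11 : (1 , 1) ≢ r
      r≢11 refl = b⋠11 b≼r
      third : GoodIn r x ⊎ BadIn r x → Connected (suc n) x
      third (inj₁ gr)   = good-good px 11∈x q∈ cq r∈x co′ q≢r q≢11 r≢11 gq gr
      third (inj₂ bad′) = ⊥-elim (bad-unique r≢e e∈ bad′ bad)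

  -- Here s₁ = p is the only box with which tₙ fixes s₁ ∷ r ∷ z.
  single-corner : ∀ {x i j} → let r = (i , suc j) ; p = right r in
    Pt (suc n) x → (1 , 1) ∈ x → p ∈ x → Corner p x → GoodIn p x → (1 , 1) ≢ p → (1 , 1) ≢ r →
    (suc i , j) ∉ x → Connected (suc n) x
  single-corner {x} {i} {j} (v , len) 11∈x p∈ cp good p≢11 r≢11 blocked with pull v p∈ cp
  ... | u , V@((p∉u , clp) ∷ vu) , x↭ with pull vu (clp (inj₁ refl)) cr
    where
    -- A box below (i , suc j) would bring the forbidden box (suc i , j) with it.
    cr : Corner (i , suc j) u
    cr (inj₁ refl) c∈ = p∉u c∈
    cr (inj₂ refl) c∈ = blocked (∈-resp-↭ (↭-sym x↭) (there (Valid-closed vu c∈ (inj₁ refl))))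
  ... | κ , vrκ , u↭ = Connected-↭ (v , len) shape (over⇒Connected pA over (Pt-tail pA) ↭-refl (inj₁ (inj₁ tA)))
    where
    p r : Box
    p = (i , suc (suc j))
    r = (i , suc j)
    x↭′ : x ↭ p ∷ r ∷ κ
    x↭′ = ↭-trans x↭ (↭-prep p u↭)
    11∈κ : (1 , 1) ∈ κ
    11∈κ = off-head r≢11 (off-head p≢11 (∈-resp-↭ x↭′ 11∈x))
    len-κ : length κ ≡ m
    len-κ = suc-injective (suc-injective (trans (sym (↭-length x↭′)) len))
    five : Five m κ
    five = fives (Valid-tail vrκ , len-κ) 11∈κ
    module F = Five five
    module S = Step full m≥2 five 11∈κ vrκ vrκ
    z : Path
    z = F.member 0F
    len-z : length z ≡ m
    len-z = proj₂ (F.pt 0F)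
    vrz : Valid (r ∷ z)
    vrz = Valid-∷-↭ vrκ (proj₁ (F.pt 0F)) (F.shape 0F)
    rz↭u : r ∷ z ↭ u
    rz↭u = ↭-trans (↭-prep r (F.shape 0F)) (↭-sym u↭)
    pA : Pt (suc n) (p ∷ r ∷ z)
    pA = Valid-∷-↭ V vrz rz↭u , cong (suc ∘ suc) len-z
    shape : x ↭ p ∷ r ∷ z
    shape = ↭-trans x↭ (↭-prep p (↭-sym rz↭u))
    tA : t n (p ∷ r ∷ z) ≡ p ∷ r ∷ z
    tA = t-touch len-z (inj₂ (inj₁ refl))
    unique : ∀ s₁ s₂ → Pt (suc n) (s₁ ∷ r ∷ z) → t n (s₁ ∷ r ∷ z) ≡ s₂ ∷ r ∷ z → s₁ ≡ p
    unique s₁ s₂ ((s∉ , cl) ∷ (_ , clr) ∷ _ , _) e with touch? s₁ r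
    ... | no ¬tc = contradiction (here (∷-injectiveˡ (∷-injectiveʳ (trans (sym (t-apart {z = z} len-z ¬tc)) e)))) s∉
    ... | yes (inj₁ s⋖r) = contradiction (there (clr s⋖r)) s∉
    ... | yes (inj₂ (inj₁ eq)) = eq
    ... | yes (inj₂ (inj₂ refl)) =
        contradiction (∈-resp-↭ (↭-sym shape) (there (cl (inj₁ refl)))) blocked
    over : Over p (r ∷ z)
    over = Pair≈⇒Over pA (there (∈-resp-↭ (↭-sym (F.shape 0F)) 11∈κ)) (GoodIn⇒Good (proj₁ pA) shape good)
      (S.pairˢ pA tA unique)

  private
    -- For `i = 0` the shape is (j + 1, 2), otherwise the rectangle with corner (i , j). A rectangle
    -- that is not a square stays asymmetric without its corner, and the corner of a square is on
    -- the diagonal, so the corner is good.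
    few-corners-row : ∀ {x i j} → Pt (suc n) x → (1 , 1) ∈ x → (i , j) ∈ x → Corner (i , j) x → (1 , 1) ≢ (i , j) →
      (∀ {b} → b ∈ x → b ≼ (i , j) ⊎ b ≼ (1 , 1)) → i ≤ j → Connected (suc n) x
    few-corners-row {x} {zero} {j} px@(v , len) 11∈ p∈ cp p≢ bound i≤j with j ≤? 4
    ... | yes j≤4 = ⊥-elim (too-long 7 v (subst (7 <_) (sym len) (s≤s (s≤s m≥6))) sub ≤-refl)
      where
      sub : x ⊆ (1 , 0) ∷ (1 , 1) ∷ grid (0 , 4)
      sub {b} b∈ with bound b∈
      ... | inj₁ (p , p′) = there (there (∈-grid (p , ≤-trans p′ j≤4)))
      sub {zero , l} b∈ | inj₂ (_ , p′) = there (there (∈-grid {c = 0 , 4} (z≤n , ≤-trans p′ (s≤s z≤n))))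
      sub {suc zero , zero} b∈ | inj₂ _ = here refl
      sub {suc zero , suc zero} b∈ | inj₂ _ = there (here refl)
      sub {suc zero , suc (suc l)} b∈ | inj₂ (_ , s≤s ())
      sub {suc (suc k) , l} b∈ | inj₂ (s≤s () , _)
    ... | no j≰4 with ≰⇒> j≰4
    ... | s≤s (s≤s (s≤s (s≤s (s≤s {n = j′} z≤n)))) = single-corner px 11∈ p∈ cp (inj₂ notself) p≢ (λ ()) (outside ∘ bound)
      where
      outside : ∀ {k l} → ¬ ((suc k , suc (suc l)) ≼ (0 , j) ⊎ (suc k , suc (suc l)) ≼ (1 , 1))
      outside (inj₁ (() , _))
      outside (inj₂ (_ , s≤s ()))
      notself : ¬ SelfTOff (0 , suc (suc (suc (suc (suc j′))))) x
      notself s with bound (proj₁ (s (Valid-closed v p∈ (inj₁ refl)) (λ ())))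
      ... | inj₁ (() , _)
      ... | inj₂ (s≤s () , _)
    few-corners-row {x} {suc i} {j} px@(v , len) 11∈ p∈ cp p≢ bound (s≤s {n = j′} i≤j) = large i j′ i≤j refl refl
      where
      within : ∀ {b} → b ∈ x → b ≼ (suc i , j)
      within b∈ with bound b∈
      ... | inj₁ p = p
      ... | inj₂ (p , p′) = ≤-trans p (s≤s z≤n) , ≤-trans p′ (s≤s z≤n)
      good : GoodIn (suc i , j) x
      good with i ≟ j′
      ... | yes refl = inj₁ refl
      ... | no i≢ = inj₂ λ s → contradiction (proj₁ (within (proj₁ (s {0 , j} (Valid-closed-≼ v p∈ (z≤n , ≤-refl)) (λ ())))))
              (λ p → i≢ (≤-antisym i≤j (≤-pred p)))
      large : ∀ i″ j″ → i″ ≤ j″ → i″ ≡ i → j″ ≡ j′ → Connected (suc n) x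
      large zero zero _ refl refl = contradiction refl p≢
      -- In the 2 × 3 rectangle the box left of the corner is (1 , 1), whose removal would leave a
      -- hook; this shape has only six boxes.
      large zero (suc zero) _ refl refl = ⊥-elim (too-long 7 v (subst (7 <_) (sym len) (s≤s (s≤s m≥6))) (λ b∈ → ∈-grid (within b∈)) (n≤1+n 6))
      large zero (suc (suc k)) _ refl refl = single-corner px 11∈ p∈ cp good p≢ (λ ()) (λ b∈ → 1+n≰n (proj₁ (within b∈)))
      large (suc _) (suc k) _ refl refl = single-corner px 11∈ p∈ cp good p≢ (λ ()) (λ b∈ → 1+n≰n (proj₁ (within b∈)))

  few-corners : ∀ {x p} → Pt (suc n) x → (1 , 1) ∈ x → p ∈ x → Corner p x → (1 , 1) ≢ p →
    (∀ {b} → b ∈ x → b ≼ p ⊎ b ≼ (1 , 1)) → Connected (suc n) x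
  few-corners {x} {i , j} px 11∈ p∈ cp p≢ bound with ≤-total i j
  ... | inj₁ i≤j = few-corners-row px 11∈ p∈ cp p≢ bound i≤j
  ... | inj₂ j≤i = Connected-~ (inj₂ (sym (flip-flip x)))
        (few-corners-row (Pt-~ (inj₂ refl) px) (∈-flip 11∈) (∈-flip p∈)
          (λ c d∈ → cp (⋖-swap c) (∈-unflip d∈)) (p≢ ∘ cong swap) bound′ j≤i)
    where
    bound′ : ∀ {b} → b ∈ flip x → b ≼ (j , i) ⊎ b ≼ (1 , 1)
    bound′ b∈ with bound (∈-unflip b∈)
    ... | inj₁ (p , p′) = inj₁ (p′ , p)
    ... | inj₂ (p , p′) = inj₂ (p′ , p)

  -- The corner (1 , 1) is avoided throughout, since removing it leaves a hook, about which the
  -- induction hypothesis says nothing.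
  full-suc : Full (suc n)
  full-suc {x} px@(v , len) 11∈ with escape x (1 , 1) (1 , 1)
  ... | inj₂ bound = ⊥-elim (too-long 7 v (subst (7 <_) (sym len) (s≤s (s≤s m≥6)))
          (λ b∈ → ∈-grid ([ id , id ]′ (bound b∈))) (s≤s (s≤s (s≤s (s≤s z≤n)))))
  ... | inj₁ (b , b∈ , b⋠ , _) with corner-above v b∈
  ... | p , p∈ , b≼p , cp with escape x p (1 , 1)
  ... | inj₂ bound = few-corners px 11∈ p∈ cp (λ { refl → b⋠ b≼p }) bound
  ... | inj₁ (c , c∈ , c⋠p , c⋠11) with corner-above v c∈
  ... | q , q∈ , c≼q , cq with good⊎bad p x | good⊎bad q x
  ... | inj₁ gp | inj₁ gq = good-good px 11∈ p∈ cp q∈ cq (λ { refl → c⋠p c≼q }) (λ { refl → b⋠ b≼p }) (λ { refl → c⋠11 c≼q }) gp gq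
  ... | inj₁ gp | inj₂ bq = bad-good px 11∈ q∈ cq p∈ cp (λ { refl → c⋠p c≼q }) (λ { refl → c⋠11 c≼q }) (λ { refl → b⋠ b≼p }) bq gp
  ... | inj₂ bp | inj₁ gq = bad-good px 11∈ p∈ cp q∈ cq (λ { refl → c⋠p c≼q }) (λ { refl → b⋠ b≼p }) (λ { refl → c⋠11 c≼q }) bp gq
  ... | inj₂ bp | inj₂ bq = ⊥-elim (bad-unique (λ { refl → c⋠p c≼q }) q∈ bp bq)

-- Shapes with five, six and seven boxes

-- The check by `refl` evaluates only the Boolean `does d`, not the proof it certifies.
witness : ∀ {P : Set} (d : Dec P) → does d ≡ true → P
witness (yes p) _ = p

covered : Box → List Box
covered (zero  , zero)  = []
covered (suc i , zero)  = (i , 0) ∷ []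
covered (zero  , suc j) = (0 , j) ∷ []
covered (suc i , suc j) = (i , suc j) ∷ (suc i , j) ∷ []

covered-⋖ : ∀ b → All (_⋖ b) (covered b)
covered-⋖ (zero  , zero)  = []
covered-⋖ (suc i , zero)  = inj₂ refl ∷ []
covered-⋖ (zero  , suc j) = inj₁ refl ∷ []
covered-⋖ (suc i , suc j) = inj₂ refl ∷ inj₁ refl ∷ []

Fits : Path → Box → Set
Fits r b = b ∉ r × All (_∈ r) (covered b)

fits? : ∀ r → Decidable (Fits r)
fits? r b = ¬? (b ∈? r) ×-dec all? (_∈? r) (covered b)

-- An addable box outside the first column is the right neighbour of a box of `r`. Using `down` in
-- the first column only proposes each box once, which keeps `paths` free of repetitions.
candidates : Path → List Box
candidates r = (0 , 0) ∷ map right r ++ map down (filter (λ b → proj₂ b ≟ 0) r)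

paths : ℕ → List Path
paths zero    = [] ∷ []
paths (suc n) = concatMap (λ r → map (_∷ r) (filter (fits? r) (candidates r))) (paths n)

paths-complete : ∀ n {x} → Pt n x → x ∈ paths n
paths-complete zero {[]} _ = here refl
paths-complete (suc n) {b ∷ r} ((b∉ , cl) ∷ v , len) =
  ∈-concatMap⁺ (λ r → map (_∷ r) (filter (fits? r) (candidates r)))
    (lose (paths-complete n (v , suc-injective len))
      (∈-map⁺ (_∷ r) (∈-filter⁺ (fits? r) (candidate b cl) (b∉ , All.map cl (covered-⋖ b)))))
  where
  candidate : ∀ b → (∀ {c} → c ⋖ b → c ∈ r) → b ∈ candidates r
  candidate (zero  , zero)  cl = here refl
  candidate (i , suc j) cl = there (∈-++⁺ˡ (∈-map⁺ right (cl (inj₁ refl))))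
  candidate (suc i , zero)  cl =
    there (∈-++⁺ʳ (map right r) (∈-map⁺ down (∈-filter⁺ (λ b → proj₂ b ≟ 0) (cl (inj₂ refl)) refl)))

valid? : ∀ x → Dec (Valid x)
valid? []      = yes []
valid? (b ∷ r) with fits? r b | valid? r
... | no ¬f | _ = no λ { ((b∉ , cl) ∷ _) → ¬f (b∉ , All.map cl (covered-⋖ b)) }
... | yes _ | no ¬v = no (¬v ∘ Valid-tail)
... | yes (b∉ , c∈) | yes v = yes ((b∉ , cl b c∈) ∷ v)
  where
  cl : ∀ b → All (_∈ r) (covered b) → ∀ {c} → c ⋖ b → c ∈ r
  cl (zero  , suc j) (p ∷ _) (inj₁ refl) = p
  cl (suc i , suc j) (_ ∷ p ∷ _) (inj₁ refl) = p
  cl (suc i , zero)  (p ∷ _) (inj₂ refl) = p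
  cl (suc i , suc j) (p ∷ _) (inj₂ refl) = p

pt? : ∀ n x → Dec (Pt n x)
pt? n x = valid? x ×-dec (length x ≟ n)

word? : ∀ n w → Dec (Word n w)
word? n = all? (λ i → (1 ≤? i) ×-dec (i <? n))

-- A power removes the cycles whose length divides the exponent: fourth powers keep cycles of length
-- 3, cubes keep those of length 2. The cube of a product of consecutive generators tᵢ and tᵢ₊₁
-- moves a tableau only if boxes i, i + 1, i + 2 are three boxes of a 2 × 2 square. Its conjugates
-- thus have small supports, which suits commutators.
pow : ℕ → List ℕ → List ℕ
pow zero    w = []
pow (suc k) w = w ++ pow k w

conjugate commutator : List ℕ → List ℕ → List ℕ
conjugate  v w = v ++ w ++ reverse v
commutator v w = v ++ w ++ reverse v ++ reverse w

-- The cycle (a b c), and words carrying the pair a , b to the pairs origin , tᵢ origin.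
record Seed : Set where
  field
    cycle  : List ℕ
    a b c  : Path
    origin : Path
    links  : List (List ℕ)

module _ (n : ℕ) (seed : Seed) where
  open Seed seed

  Cycles : Set
  Cycles = Word n cycle × (Pt n a × Pt n b × Pt n c) × (a ≁ b × b ≁ c × c ≁ a)
    × (act cycle a ~ b × act cycle b ~ c × act cycle c ~ a)
    × All (λ x → (x ~ a ⊎ x ~ b ⊎ x ~ c) ⊎ act cycle x ≡ x) (paths n)

  cycles? : Dec Cycles
  cycles? = word? n cycle ×-dec (pt? n a ×-dec pt? n b ×-dec pt? n c)
    ×-dec (¬? (a ~? b) ×-dec ¬? (b ~? c) ×-dec ¬? (c ~? a))
    ×-dec (act cycle a ~? b ×-dec act cycle b ~? c ×-dec act cycle c ~? a)
    ×-dec all? (λ x → ((x ~? a) ⊎-dec (x ~? b) ⊎-dec (x ~? c)) ⊎-dec (act cycle x ≟ᴾ x)) (paths n)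

  Cycles⇒Tri : Cycles → Tri n a b c
  Cycles⇒Tri (ok , (pa , pb , pc) , (ab , bc , ca) , (fa , fb , fc) , others) = record
    { word = cycle ; word-ok = ok ; ptᵃ = pa ; ptᵇ = pb ; ptᶜ = pc ; a≁b = ab ; b≁c = bc ; c≁a = ca
    ; a→b = fa ; b→c = fb ; c→a = fc
    ; fix = λ px x≁a x≁b x≁c → case All.lookup others (paths-complete n px) of λ where
        (inj₁ (inj₁ p))        → contradiction p x≁a
        (inj₁ (inj₂ (inj₁ p))) → contradiction p x≁b
        (inj₁ (inj₂ (inj₂ p))) → contradiction p x≁c
        (inj₂ e)               → e }

  Links : Set
  Links = Pt n origin × All (Word n) links
    × All (λ i → t i origin ~ origin ⊎ Any (λ v → act v a ~ origin × act v b ~ t i origin) links) (upTo n)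

  links? : Dec Links
  links? = pt? n origin ×-dec all? (word? n) links
    ×-dec all? (λ i → (t i origin ~? origin) ⊎-dec any? (λ v → (act v a ~? origin) ×-dec (act v b ~? t i origin)) links) (upTo n)

  seed⇒Connected : Cycles → Links → Connected n origin
  seed⇒Connected cyc (po , oks , stable) = stable⇒Connected po λ i _ i<n → case All.lookup stable (∈-upTo⁺ i<n) of λ where
      (inj₁ p) → inj₁ p
      (inj₂ p) → let (v , v∈ , a~ , b~) = find p in
        inj₂ (_ , Tri-swap (Tri-resp (~-sym a~) (~-sym b~) ~-refl (Tri-act v (All.lookup oks v∈) (Cycles⇒Tri cyc))))

Covers : ℕ → List Seed → Set
Covers n seeds = All (λ x → (1 , 1) ∈ x → Any (λ s → All (_∈ Seed.origin s) x ⊎ All (_∈ Seed.origin s) (flip x)) seeds) (paths n)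

covers? : ∀ n seeds → Dec (Covers n seeds)
covers? n seeds = all? (λ x → ((1 , 1) ∈? x) →-dec
  any? (λ s → all? (_∈? Seed.origin s) x ⊎-dec all? (_∈? Seed.origin s) (flip x)) seeds) (paths n)

seeds⇒Full : ∀ n seeds → Covers n seeds → All (λ s → Cycles n s × Links n s) seeds → Full n
seeds⇒Full n seeds cov good {x} px 11∈ with find (All.lookup cov (paths-complete n px) 11∈)
... | s , s∈ , inside with All.lookup good s∈
... | cyc , lnk = go inside
  where
  shape : ∀ {y} → Pt n y → All (_∈ Seed.origin s) y → y ↭ Seed.origin s
  shape (v , len) sub = Unique-⊆-↭ (Valid-unique v) (All.lookup sub)
    (≤-reflexive (trans (proj₂ (proj₁ lnk)) (sym len)))
  go : All (_∈ Seed.origin s) x ⊎ All (_∈ Seed.origin s) (flip x) → Connected n x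
  go (inj₁ sub) = Connected-↭ px (shape px sub) (seed⇒Connected n s cyc lnk)
  go (inj₂ sub) = Connected-~ (inj₂ (sym (flip-flip x)))
    (Connected-↭ pfx (shape pfx sub) (seed⇒Connected n s cyc lnk))
    where
    pfx : Pt n (flip x)
    pfx = Pt-~ (inj₂ refl) px

-- Words found by computer search; seed-λ is for the shape λ.
seed-32 : Seed
seed-32 = record
  { cycle  = pow 4 (4 ∷ 3 ∷ 2 ∷ [])
  ; a      = (0 , 2) ∷ (1 , 1) ∷ (1 , 0) ∷ (0 , 1) ∷ (0 , 0) ∷ []
  ; b      = (1 , 1) ∷ (0 , 2) ∷ (0 , 1) ∷ (1 , 0) ∷ (0 , 0) ∷ []
  ; c      = (1 , 1) ∷ (1 , 0) ∷ (0 , 2) ∷ (0 , 1) ∷ (0 , 0) ∷ []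
  ; origin = (1 , 1) ∷ (1 , 0) ∷ (0 , 2) ∷ (0 , 1) ∷ (0 , 0) ∷ []
  ; links  = (4 ∷ 2 ∷ 3 ∷ 4 ∷ []) ∷ [] }

full-5 : Full 5
full-5 = seeds⇒Full 5 (seed-32 ∷ []) (witness (covers? 5 (seed-32 ∷ [])) refl)
  ((witness (cycles? 5 seed-32) refl , witness (links? 5 seed-32) refl) ∷ [])

seed-33 : Seed
seed-33 = record
  { cycle  = pow 4 (5 ∷ 4 ∷ 3 ∷ 4 ∷ 3 ∷ [])
  ; a      = (1 , 2) ∷ (0 , 2) ∷ (1 , 1) ∷ (1 , 0) ∷ (0 , 1) ∷ (0 , 0) ∷ []
  ; b      = (1 , 2) ∷ (1 , 1) ∷ (1 , 0) ∷ (0 , 2) ∷ (0 , 1) ∷ (0 , 0) ∷ []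
  ; c      = (1 , 2) ∷ (1 , 1) ∷ (0 , 2) ∷ (1 , 0) ∷ (0 , 1) ∷ (0 , 0) ∷ []
  ; origin = (1 , 2) ∷ (1 , 1) ∷ (1 , 0) ∷ (0 , 2) ∷ (0 , 1) ∷ (0 , 0) ∷ []
  ; links  = (3 ∷ 4 ∷ []) ∷ [] }

seed-42 : Seed
seed-42 = record
  { cycle  = pow 4 (5 ∷ 4 ∷ 5 ∷ 4 ∷ 3 ∷ [])
  ; a      = (0 , 3) ∷ (1 , 1) ∷ (0 , 2) ∷ (0 , 1) ∷ (1 , 0) ∷ (0 , 0) ∷ []
  ; b      = (1 , 1) ∷ (0 , 3) ∷ (0 , 2) ∷ (0 , 1) ∷ (1 , 0) ∷ (0 , 0) ∷ []
  ; c      = (0 , 3) ∷ (0 , 2) ∷ (1 , 1) ∷ (0 , 1) ∷ (1 , 0) ∷ (0 , 0) ∷ []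
  ; origin = (1 , 1) ∷ (1 , 0) ∷ (0 , 3) ∷ (0 , 2) ∷ (0 , 1) ∷ (0 , 0) ∷ []
  ; links  = (4 ∷ 5 ∷ 4 ∷ 3 ∷ 2 ∷ []) ∷ [] }

seed-321 : Seed
seed-321 = record
  { cycle  = commutator (conjugate (2 ∷ []) (pow 3 (3 ∷ 4 ∷ []))) (conjugate (5 ∷ []) (pow 3 (3 ∷ 4 ∷ [])))
  ; a      = (2 , 0) ∷ (0 , 2) ∷ (1 , 1) ∷ (1 , 0) ∷ (0 , 1) ∷ (0 , 0) ∷ []
  ; b      = (2 , 0) ∷ (1 , 1) ∷ (0 , 2) ∷ (1 , 0) ∷ (0 , 1) ∷ (0 , 0) ∷ []
  ; c      = (1 , 1) ∷ (0 , 2) ∷ (2 , 0) ∷ (1 , 0) ∷ (0 , 1) ∷ (0 , 0) ∷ []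
  ; origin = (2 , 0) ∷ (1 , 1) ∷ (1 , 0) ∷ (0 , 2) ∷ (0 , 1) ∷ (0 , 0) ∷ []
  ; links  = (3 ∷ 4 ∷ 3 ∷ []) ∷ (3 ∷ 4 ∷ 5 ∷ 2 ∷ []) ∷ [] }

full-6 : Full 6
full-6 = seeds⇒Full 6 (seed-33 ∷ seed-42 ∷ seed-321 ∷ []) (witness (covers? 6 (seed-33 ∷ seed-42 ∷ seed-321 ∷ [])) refl)
  ((witness (cycles? 6 seed-33) refl , witness (links? 6 seed-33) refl) ∷ (witness (cycles? 6 seed-42) refl , witness (links? 6 seed-42) refl) ∷ (witness (cycles? 6 seed-321) refl , witness (links? 6 seed-321) refl) ∷ [])

seed-43 : Seed
seed-43 = record
  { cycle  = commutator (conjugate (3 ∷ 4 ∷ []) (pow 3 (5 ∷ 6 ∷ []))) (conjugate (5 ∷ 4 ∷ []) (pow 3 (5 ∷ 6 ∷ [])))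
  ; a      = (1 , 2) ∷ (0 , 3) ∷ (1 , 1) ∷ (0 , 2) ∷ (0 , 1) ∷ (1 , 0) ∷ (0 , 0) ∷ []
  ; b      = (1 , 2) ∷ (1 , 1) ∷ (0 , 3) ∷ (0 , 2) ∷ (0 , 1) ∷ (1 , 0) ∷ (0 , 0) ∷ []
  ; c      = (0 , 3) ∷ (1 , 2) ∷ (1 , 1) ∷ (0 , 2) ∷ (0 , 1) ∷ (1 , 0) ∷ (0 , 0) ∷ []
  ; origin = (1 , 2) ∷ (1 , 1) ∷ (1 , 0) ∷ (0 , 3) ∷ (0 , 2) ∷ (0 , 1) ∷ (0 , 0) ∷ []
  ; links  = (4 ∷ 5 ∷ 4 ∷ 3 ∷ 2 ∷ []) ∷ [] }

seed-331 : Seed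
seed-331 = record
  { cycle  = commutator (conjugate (5 ∷ 4 ∷ []) (pow 3 (5 ∷ 6 ∷ []))) (conjugate (6 ∷ []) (pow 4 (3 ∷ 4 ∷ 3 ∷ 4 ∷ 5 ∷ [])))
  ; a      = (1 , 2) ∷ (2 , 0) ∷ (1 , 1) ∷ (0 , 2) ∷ (1 , 0) ∷ (0 , 1) ∷ (0 , 0) ∷ []
  ; b      = (1 , 2) ∷ (2 , 0) ∷ (1 , 1) ∷ (1 , 0) ∷ (0 , 2) ∷ (0 , 1) ∷ (0 , 0) ∷ []
  ; c      = (1 , 2) ∷ (2 , 0) ∷ (0 , 2) ∷ (1 , 1) ∷ (1 , 0) ∷ (0 , 1) ∷ (0 , 0) ∷ []
  ; origin = (2 , 0) ∷ (1 , 2) ∷ (1 , 1) ∷ (1 , 0) ∷ (0 , 2) ∷ (0 , 1) ∷ (0 , 0) ∷ []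
  ; links  = (6 ∷ 3 ∷ []) ∷ (3 ∷ 4 ∷ 5 ∷ 6 ∷ 4 ∷ 5 ∷ 3 ∷ 4 ∷ 5 ∷ 3 ∷ []) ∷ [] }

seed-421 : Seed
seed-421 = record
  { cycle  = commutator (conjugate (3 ∷ 4 ∷ []) (pow 3 (5 ∷ 6 ∷ []))) (conjugate (2 ∷ []) (pow 4 (3 ∷ 4 ∷ 5 ∷ 4 ∷ 5 ∷ [])))
  ; a      = (1 , 1) ∷ (2 , 0) ∷ (0 , 3) ∷ (0 , 2) ∷ (1 , 0) ∷ (0 , 1) ∷ (0 , 0) ∷ []
  ; b      = (2 , 0) ∷ (0 , 3) ∷ (1 , 1) ∷ (0 , 2) ∷ (1 , 0) ∷ (0 , 1) ∷ (0 , 0) ∷ []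
  ; c      = (2 , 0) ∷ (1 , 1) ∷ (0 , 3) ∷ (0 , 2) ∷ (1 , 0) ∷ (0 , 1) ∷ (0 , 0) ∷ []
  ; origin = (1 , 1) ∷ (2 , 0) ∷ (1 , 0) ∷ (0 , 3) ∷ (0 , 2) ∷ (0 , 1) ∷ (0 , 0) ∷ []
  ; links  = (5 ∷ 6 ∷ 5 ∷ 6 ∷ 4 ∷ 3 ∷ []) ∷ (4 ∷ 5 ∷ 3 ∷ 4 ∷ 2 ∷ 3 ∷ 4 ∷ 3 ∷ 4 ∷ 5 ∷ 4 ∷ 2 ∷ []) ∷ [] }

seed-52 : Seed
seed-52 = record
  { cycle  = commutator (conjugate (2 ∷ []) (pow 4 (5 ∷ 4 ∷ 5 ∷ 4 ∷ 3 ∷ []))) (conjugate (3 ∷ 2 ∷ 6 ∷ []) (pow 4 (5 ∷ 4 ∷ 5 ∷ 4 ∷ 3 ∷ [])))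
  ; a      = (0 , 4) ∷ (0 , 3) ∷ (1 , 1) ∷ (0 , 2) ∷ (1 , 0) ∷ (0 , 1) ∷ (0 , 0) ∷ []
  ; b      = (0 , 4) ∷ (0 , 3) ∷ (1 , 1) ∷ (1 , 0) ∷ (0 , 2) ∷ (0 , 1) ∷ (0 , 0) ∷ []
  ; c      = (0 , 4) ∷ (0 , 3) ∷ (0 , 2) ∷ (1 , 1) ∷ (1 , 0) ∷ (0 , 1) ∷ (0 , 0) ∷ []
  ; origin = (1 , 1) ∷ (1 , 0) ∷ (0 , 4) ∷ (0 , 3) ∷ (0 , 2) ∷ (0 , 1) ∷ (0 , 0) ∷ []
  ; links  = (4 ∷ 5 ∷ 6 ∷ 3 ∷ 4 ∷ 5 ∷ 3 ∷ []) ∷ [] }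

full-7 : Full 7
full-7 = seeds⇒Full 7 (seed-43 ∷ seed-331 ∷ seed-421 ∷ seed-52 ∷ []) (witness (covers? 7 (seed-43 ∷ seed-331 ∷ seed-421 ∷ seed-52 ∷ [])) refl)
  ((witness (cycles? 7 seed-43) refl , witness (links? 7 seed-43) refl) ∷ (witness (cycles? 7 seed-331) refl , witness (links? 7 seed-331) refl) ∷ (witness (cycles? 7 seed-421) refl , witness (links? 7 seed-421) refl) ∷ (witness (cycles? 7 seed-52) refl , witness (links? 7 seed-52) refl) ∷ [])

-- Five classes in every shape, and the induction on the number of boxes

Five-flip : ∀ {n x} → Five n (flip x) → Five n x
Five-flip {n} {x} five = record
  { member   = flip ∘ member
  ; pt       = λ i → Pt-~ (inj₂ refl) (pt i)
  ; shape    = λ i → subst (flip (member i) ↭_) (flip-flip x) (map⁺ swap (shape i))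
  ; distinct = λ ne e → distinct ne (~-trans (inj₂ (sym (flip-flip _))) (~-trans e (inj₂ refl))) }
  where open Five five

five-32 : Five 5 (Seed.origin seed-32)
five-32 = record
  { member   = member
  ; pt       = witness (allFin? (λ i → pt? 5 (member i))) refl
  ; shape    = λ i → Unique-⊆-↭ (Valid-unique (proj₁ (witness (allFin? (λ i → pt? 5 (member i))) refl i)))
      (All.lookup (witness (allFin? (λ i → all? (_∈? Seed.origin seed-32) (member i))) refl i))
      (≤-reflexive (sym (proj₂ (witness (allFin? (λ i → pt? 5 (member i))) refl i))))
  ; distinct = λ {i} {j} → witness (allFin? (λ i → allFin? (λ j → ¬? (i ≟ᶠ j) →-dec ¬? (member i ~? member j)))) refl i j }
  where
  member : Fin 5 → Path
  member 0F = (1 , 1) ∷ (1 , 0) ∷ (0 , 2) ∷ (0 , 1) ∷ (0 , 0) ∷ []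
  member 1F = (1 , 1) ∷ (0 , 2) ∷ (1 , 0) ∷ (0 , 1) ∷ (0 , 0) ∷ []
  member 2F = (1 , 1) ∷ (0 , 2) ∷ (0 , 1) ∷ (1 , 0) ∷ (0 , 0) ∷ []
  member 3F = (0 , 2) ∷ (1 , 1) ∷ (1 , 0) ∷ (0 , 1) ∷ (0 , 0) ∷ []
  member 4F = (0 , 2) ∷ (1 , 1) ∷ (0 , 1) ∷ (1 , 0) ∷ (0 , 0) ∷ []

-- Remove corners other than (1 , 1) until five boxes are left, which form (3,2) or its transpose.
-- Putting a box back keeps classes distinct by `~-tail`.
fives : ∀ n → 5 ≤ n → ∀ {x} → Pt n x → (1 , 1) ∈ x → Five n x
fives n 5≤n {x} px 11∈ with n ≟ 5
... | yes refl = go inside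
  where
  o : Path
  o = Seed.origin seed-32
  inside : All (_∈ o) x ⊎ All (_∈ o) (flip x)
  inside with All.lookup (witness (covers? 5 (seed-32 ∷ [])) refl) (paths-complete 5 px) 11∈
  ... | here p = p
  shape : ∀ {y} → Pt 5 y → All (_∈ o) y → y ↭ o
  shape (v , len) sub = Unique-⊆-↭ (Valid-unique v) (All.lookup sub) (≤-reflexive (sym len))
  go : All (_∈ o) x ⊎ All (_∈ o) (flip x) → Five 5 x
  go (inj₁ sub) = Five-↭ (↭-sym (shape px sub)) five-32
  go (inj₂ sub) = Five-flip (Five-↭ (↭-sym (shape (Pt-~ (inj₂ refl) px) sub)) five-32)
fives n 5≤n {x} px@(v , len) 11∈ | no n≢5 with ≤∧≢⇒< 5≤n (n≢5 ∘ sym)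
fives (suc n) 5≤n {x} px@(v , len) 11∈ | no n≢5 | s≤s 5≤n′ with escape x (1 , 1) (1 , 1)
... | inj₂ bound = ⊥-elim (too-long 5 v (subst (5 <_) (sym len) (s≤s 5≤n′))
        (λ b∈ → ∈-grid ([ id , id ]′ (bound b∈))) (n≤1+n 4))
... | inj₁ (b , b∈ , b⋠ , _) with corner-above v b∈
... | p , p∈ , b≼p , co with pull v p∈ co
... | r , V , x↭ = Five-↭ (↭-sym x↭) (Five-∷ V (fives n 5≤n′
        (Valid-tail V , suc-injective (trans (sym (↭-length x↭)) len))
        (off-head (λ { refl → b⋠ b≼p }) (∈-resp-↭ x↭ 11∈))))

full-7+ : ∀ k → Full (7 + k)
full-7+ zero    = full-7
full-7+ (suc k) = Induction.full-suc m≥6 (full-7+ k) (fives (6 + k) (≤-trans (n≤1+n 5) m≥6))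
  where
  m≥6 : 6 ≤ 6 + k
  m≥6 = s≤s (s≤s (s≤s (s≤s (s≤s (s≤s z≤n)))))

full : ∀ n → 5 ≤ n → Full n
full 5 _ = full-5
full 6 _ = full-6
full (suc (suc (suc (suc (suc (suc (suc k))))))) _ = full-7+ k
full 0 ()
full 1 (s≤s ())
full 2 (s≤s (s≤s ()))
full 3 (s≤s (s≤s (s≤s ())))
full 4 (s≤s (s≤s (s≤s (s≤s ()))))

-- Transpositions and parity

module Transpositions {X : Set} (_≟ˣ_ : DecidableEquality X) where

  exchange : X → X → X → X
  exchange x y z with z ≟ˣ x
  ... | yes _ = y
  ... | no _ with z ≟ˣ y
  ... | yes _ = x
  ... | no _  = z

  exchangeˡ : ∀ x y → exchange x y x ≡ y
  exchangeˡ x y with x ≟ˣ x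
  ... | yes _ = refl
  ... | no ne = contradiction refl ne

  exchangeʳ : ∀ x y → exchange x y y ≡ x
  exchangeʳ x y with y ≟ˣ x
  ... | yes e = e
  ... | no _ with y ≟ˣ y
  ... | yes _ = refl
  ... | no ne = contradiction refl ne

  exchange-other : ∀ {x y z} → z ≢ x → z ≢ y → exchange x y z ≡ z
  exchange-other {x} {y} {z} z≢x z≢y with z ≟ˣ x
  ... | yes e = contradiction e z≢x
  ... | no _ with z ≟ˣ y
  ... | yes e = contradiction e z≢y
  ... | no _  = refl

  exchange-transposition : ∀ {x y} → x ≢ y → IsTransposition (exchange x y)
  exchange-transposition {x} {y} ne = x , y , ne , exchangeˡ x y , exchangeʳ x y , λ z → exchange-other

  exchange-unique : ∀ {τ : X → X} {x y} → τ x ≡ y → τ y ≡ x → (∀ z → z ≢ x → z ≢ y → τ z ≡ z) →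
    ∀ z → τ z ≡ exchange x y z
  exchange-unique {x = x} {y} τx τy τo z with z ≟ˣ x
  ... | yes refl = τx
  ... | no z≢x with z ≟ˣ y
  ... | yes refl = τy
  ... | no z≢y = τo z z≢x z≢y

  exchange-involutive : ∀ x y z → exchange x y (exchange x y z) ≡ z
  exchange-involutive x y z with z ≟ˣ x
  ... | yes refl = exchangeʳ z y
  ... | no z≢x with z ≟ˣ y
  ... | yes refl = exchangeˡ x z
  ... | no z≢y   = exchange-other z≢x z≢y

  exchange-injective : ∀ x y {z w} → exchange x y z ≡ exchange x y w → z ≡ w
  exchange-injective x y {z} {w} e = trans (sym (exchange-involutive x y z))
    (trans (cong (exchange x y) e) (exchange-involutive x y w))

  compose-++ : ∀ (σs τs : List (X → X)) x → compose (σs ++ τs) x ≡ compose σs (compose τs x)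
  compose-++ []       τs x = refl
  compose-++ (σ ∷ σs) τs x = cong σ (compose-++ σs τs x)

  Decomposition : (X → X) → Set
  Decomposition f = Σ (List (X → X)) λ τs → All IsTransposition τs × (∀ x → f x ≡ compose τs x)

  decompose : (elements : List X) → (∀ x → x ∈ elements) → ∀ f → (∀ x y → f x ≡ f y → x ≡ y) → Decomposition f
  decompose elements complete f inj = moving-in elements f inj λ z z∉ → contradiction (complete z) z∉
    where
    -- `L` contains all points moved by `f`. Composing with `exchange l (f l)` makes `l` a fixed
    -- point and keeps the old ones.
    moving-in : ∀ L f → (∀ x y → f x ≡ f y → x ≡ y) → (∀ z → z ∉ L → f z ≡ z) → Decomposition f
    moving-in [] f inj fixed = [] , [] , λ x → fixed x λ ()
    moving-in (l ∷ L) f inj fixed with f l ≟ˣ l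
    ... | yes fl≡l = moving-in L f inj λ z z∉ → case z ≟ˣ l of λ where
          (yes refl) → fl≡l
          (no z≢l)   → fixed z λ { (here e) → z≢l e ; (there q) → z∉ q }
    ... | no fl≢l = exchange l (f l) ∷ proj₁ rec
          , exchange-transposition (fl≢l ∘ sym) ∷ proj₁ (proj₂ rec)
          , λ x → trans (sym (exchange-involutive l (f l) (f x))) (cong (exchange l (f l)) (proj₂ (proj₂ rec) x))
      where
      g : X → X
      g = exchange l (f l) ∘ f
      rec : Decomposition g
      rec = moving-in L g (λ x y e → inj x y (exchange-injective l (f l) e)) λ z z∉ → case z ≟ˣ l of λ where
        (yes refl) → exchangeʳ z (f z)
        (no z≢l)   →
          let fz≡z = fixed z λ { (here e) → z≢l e ; (there q) → z∉ q } in
          trans (cong (exchange l (f l)) fz≡z)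
            (exchange-other z≢l λ e → z≢l (inj z l (trans fz≡z e)))

  module Generation (G : (X → X) → Set) (G-resp : ∀ {f g} → (∀ x → f x ≡ g x) → G g → G f)
    (G-id : G id) (G-∘ : ∀ {f g} → G f → G g → G (f ∘ g))
    (G-cycle : ∀ {a b c} → a ≢ b → b ≢ c → a ≢ c →
      Σ (X → X) λ f → G f × f a ≡ b × f b ≡ c × f c ≡ a × (∀ z → z ≢ a → z ≢ b → z ≢ c → f z ≡ z)) where

    -- The product sends z to x, x to y and y to z; for `x ≡ z` it is the identity.
    chain∈G : ∀ {x y z} → x ≢ y → y ≢ z → G (exchange x y ∘ exchange y z)
    chain∈G {x} {y} {z} x≢y y≢z with x ≟ˣ z
    ... | yes refl = G-resp (λ w → trans (cong (exchange x y) (swapped w)) (exchange-involutive x y w)) G-id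
      where
      swapped : ∀ w → exchange y x w ≡ exchange x y w
      swapped = exchange-unique (exchangeʳ y x) (exchangeˡ y x) (λ w w≢x w≢y → exchange-other w≢y w≢x)
    ... | no x≢z with G-cycle (x≢z ∘ sym) x≢y (y≢z ∘ sym)
    ... | f , f∈G , fz , fx , fy , fo = G-resp eq f∈G
      where
      eq : ∀ w → exchange x y (exchange y z w) ≡ f w
      eq w with w ≟ˣ y
      ... | yes refl = trans (exchange-other (x≢z ∘ sym) (y≢z ∘ sym)) (sym fy)
      ... | no w≢y with w ≟ˣ z
      ... | yes refl = trans (exchangeʳ x y) (sym fz)
      ... | no w≢z with w ≟ˣ x
      ... | yes refl = sym fx
      ... | no w≢x with w ≟ˣ y
      ... | yes e = contradiction e w≢y
      ... | no _  = sym (fo w w≢z w≢x w≢y)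

    -- Insert the square of the transposition (y x′) in the middle, which leaves two products of
    -- transpositions with a common point.
    two∈G : ∀ {x y x′ y′} → x ≢ y → x′ ≢ y′ → G (exchange x y ∘ exchange x′ y′)
    two∈G {x} {y} {x′} {y′} x≢y x′≢y′ with y ≟ˣ x′
    ... | yes refl = chain∈G x≢y x′≢y′
    ... | no y≢x′ = G-resp
        (λ w → cong (exchange x y) (sym (exchange-involutive y x′ (exchange x′ y′ w))))
        (G-∘ (chain∈G x≢y y≢x′) (chain∈G y≢x′ x′≢y′))

    even∈G : ∀ (τs : List (X → X)) → All IsTransposition τs → 2 ∣ length τs → G (compose τs)
    even∈G [] _ _ = G-id
    even∈G (_ ∷ []) _ 2∣1 with ∣1⇒≡1 2∣1
    ... | ()
    even∈G (σ ∷ τ ∷ τs) ((x , y , x≢y , σx , σy , σo) ∷ (x′ , y′ , x′≢y′ , τx , τy , τo) ∷ ts) 2∣ =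
      G-∘ (G-resp (λ w → trans (exchange-unique σx σy σo (τ w)) (cong (exchange x y) (exchange-unique τx τy τo w)))
            (two∈G x≢y x′≢y′))
          (even∈G τs ts (∣m+n∣m⇒∣n 2∣ ∣-refl))

    EvenPerm⇒G : ∀ {f} → EvenPerm f → G f
    EvenPerm⇒G (τs , ts , 2∣ , eq) = G-resp eq (even∈G τs ts 2∣)

  EvenPerm-∘ : ∀ {f g} → EvenPerm f → EvenPerm g → EvenPerm (f ∘ g)
  EvenPerm-∘ {f} {g} (σs , σt , σ2 , σe) (τs , τt , τ2 , τe) = σs ++ τs , AllP.++⁺ σt τt
    , subst (2 ∣_) (sym (length-++ σs)) (∣m∣n⇒∣m+n σ2 τ2)
    , λ x → trans (σe (g x)) (trans (cong (compose σs) (τe x)) (sym (compose-++ σs τs x)))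

parity : ∀ n → 2 ∣ n ⊎ 2 ∣ suc n
parity zero    = inj₁ (2 ∣0)
parity (suc n) with parity n
... | inj₁ p = inj₂ (∣m∣n⇒∣m+n ∣-refl p)
... | inj₂ p = inj₁ p

-- From tableaux to paths

infix 4 _[_]↦_

data _[_]↦_ {A : Set} : List A → ℕ → A → Set where
  here  : ∀ {x xs} → (x ∷ xs) [ 0 ]↦ x
  there : ∀ {x xs j y} → xs [ j ]↦ y → (x ∷ xs) [ suc j ]↦ y

↦-functional : ∀ {A : Set} {xs : List A} {j x y} → xs [ j ]↦ x → xs [ j ]↦ y → x ≡ y
↦-functional here here = refl
↦-functional (there p) (there q) = ↦-functional p q

↦-∈ : ∀ {A : Set} {xs : List A} {j x} → xs [ j ]↦ x → x ∈ xs
↦-∈ here = here refl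
↦-∈ (there p) = there (↦-∈ p)

∈-↦ : ∀ {A : Set} {xs : List A} {x} → x ∈ xs → ∃ λ j → xs [ j ]↦ x
∈-↦ (here refl) = 0 , here
∈-↦ (there p) = let j , q = ∈-↦ p in suc j , there q

↦-map : ∀ {A B : Set} (f : A → B) {xs : List A} {j x} → xs [ j ]↦ x → map f xs [ j ]↦ f x
↦-map f here = here
↦-map f (there p) = there (↦-map f p)

↦-map⁻ : ∀ {A B : Set} (f : A → B) {xs : List A} {j y} → map f xs [ j ]↦ y → ∃ λ x → xs [ j ]↦ x × y ≡ f x
↦-map⁻ f {x ∷ xs} here = x , here , refl
↦-map⁻ f {_ ∷ xs} (there p) = let x , q , e = ↦-map⁻ f p in x , there q , e

↦-< : ∀ {A : Set} {xs : List A} {j x} → xs [ j ]↦ x → j < length xs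
↦-< here = s≤s z≤n
↦-< (there p) = s≤s (↦-< p)

<-↦ : ∀ {A : Set} {xs : List A} {j} → j < length xs → ∃ λ x → xs [ j ]↦ x
<-↦ {xs = x ∷ xs} {zero} _ = x , here
<-↦ {xs = x ∷ xs} {suc j} (s≤s p) = let y , q = <-↦ p in y , there q

↦-ext : ∀ {A : Set} {xs ys : List A} → length xs ≡ length ys → (∀ {j x} → xs [ j ]↦ x → ys [ j ]↦ x) → xs ≡ ys
↦-ext {xs = []} {[]} _ _ = refl
↦-ext {xs = x ∷ xs} {y ∷ ys} len sub = cong₂ _∷_ (↦-functional (sub here) here)
  (↦-ext (suc-injective len) (λ p → case sub (there p) of λ { (there q) → q }))

At : Tableau → Box → ℕ → Set
At T (i , j) k = ∃ λ r → T [ i ]↦ r × r [ j ]↦ k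

At-functional : ∀ {T b k l} → At T b k → At T b l → k ≡ l
At-functional (r , p , q) (r′ , p′ , q′) with ↦-functional p p′
... | refl = ↦-functional q q′

At-∈ : ∀ {T b k} → At T b k → k ∈ concat T
At-∈ (r , p , q) = ∈-concat⁺′ (↦-∈ q) (↦-∈ p)

∈-At : ∀ {T k} → k ∈ concat T → ∃ λ b → At T b k
∈-At {T} k∈ with ∈-concat⁻′ T k∈
... | r , k∈r , r∈T with ∈-↦ k∈r | ∈-↦ r∈T
... | j , q | i , p = (i , j) , r , p , q

At-∷⁻ : ∀ {r T i j k} → At (r ∷ T) (suc i , j) k → At T (i , j) k
At-∷⁻ (s , there p , q) = s , p , q

≡ᵇ-refl : ∀ k → (k ≡ᵇ k) ≡ true
≡ᵇ-refl k = Equivalence.to T-≡ (≡⇒≡ᵇ k k refl)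

≡ᵇ-≢ : ∀ {k l} → k ≢ l → (k ≡ᵇ l) ≡ false
≡ᵇ-≢ {k} {l} ne with k ≡ᵇ l in eq
... | false = refl
... | true  = contradiction (≡ᵇ⇒≡ k l (Equivalence.from T-≡ eq)) ne

∧-true : ∀ {a b} → a ∧ b ≡ true → a ≡ true × b ≡ true
∧-true {true} {true} _ = refl , refl

∧-intro : ∀ {a b} → a ≡ true → b ≡ true → a ∧ b ≡ true
∧-intro refl refl = refl

allB-true : ∀ {A : Set} {f : A → Bool} xs → allB f xs ≡ true → ∀ {x} → x ∈ xs → f x ≡ true
allB-true (x ∷ xs) e (here refl) = proj₁ (∧-true e)
allB-true (x ∷ xs) e (there p)   = allB-true xs (proj₂ (∧-true e)) p

allB-intro : ∀ {A : Set} {f : A → Bool} xs → (∀ {x} → x ∈ xs → f x ≡ true) → allB f xs ≡ true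
allB-intro []       _ = refl
allB-intro (x ∷ xs) h = ∧-intro (h (here refl)) (allB-intro xs (h ∘ there))

occ-∈ : ∀ k xs → occ k xs ≡ 1 → k ∈ xs
occ-∈ k (x ∷ xs) e with x ≡ᵇ k in eq
... | true  = here (sym (≡ᵇ⇒≡ x k (Equivalence.from T-≡ eq)))
... | false = there (occ-∈ k xs e)

∈-occ : ∀ {k xs} → k ∈ xs → 1 ≤ occ k xs
∈-occ {k} (here refl) rewrite ≡ᵇ-refl k = s≤s z≤n
∈-occ {k} {x ∷ xs} (there p) with x ≡ᵇ k
... | true  = s≤s z≤n
... | false = ∈-occ p

occ-++ : ∀ k xs ys → occ k (xs ++ ys) ≡ occ k xs + occ k ys
occ-++ k []       ys = refl
occ-++ k (x ∷ xs) ys with x ≡ᵇ k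
... | true  = cong suc (occ-++ k xs ys)
... | false = occ-++ k xs ys

↦-unique : ∀ {k xs i j} → occ k xs ≤ 1 → xs [ i ]↦ k → xs [ j ]↦ k → i ≡ j
↦-unique _ here here = refl
↦-unique {k} le here (there q) rewrite ≡ᵇ-refl k = contradiction (≤-pred le) (λ h → 1+n≰n (≤-trans (∈-occ (↦-∈ q)) h))
↦-unique {k} le (there p) here rewrite ≡ᵇ-refl k = contradiction (≤-pred le) (λ h → 1+n≰n (≤-trans (∈-occ (↦-∈ p)) h))
↦-unique {k} {x ∷ xs} le (there p) (there q) with x ≡ᵇ k
... | true  = cong suc (↦-unique (≤-trans (≤-pred le) z≤n) p q)
... | false = cong suc (↦-unique le p q)

-- The bound `≤ 1`, unlike an equation, is inherited by the first row and by the remaining rows.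
At-unique : ∀ {k} T → occ k (concat T) ≤ 1 → ∀ {b c} → At T b k → At T c k → b ≡ c
At-unique {k} (r ∷ T) le {zero , j} {zero , l} (_ , here , p) (_ , here , q) =
  cong (0 ,_) (↦-unique (≤-trans (m≤m+n (occ k r) (occ k (concat T))) (subst (_≤ 1) (occ-++ k r (concat T)) le)) p q)
At-unique {k} (r ∷ T) le {zero , j} {suc i , l} (_ , here , p) (s , there p′ , q) =
  contradiction (≤-trans (+-mono-≤ (∈-occ (↦-∈ p)) (∈-occ (At-∈ (s , p′ , q)))) (subst (_≤ 1) (occ-++ k r (concat T)) le)) (1+n≰n {1})
At-unique {k} (r ∷ T) le {suc i , j} {zero , l} (s , there p′ , q) (_ , here , p) =
  contradiction (≤-trans (+-mono-≤ (∈-occ (↦-∈ p)) (∈-occ (At-∈ (s , p′ , q)))) (subst (_≤ 1) (occ-++ k r (concat T)) le)) (1+n≰n {1})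
At-unique {k} (r ∷ T) le {suc i , j} {suc i′ , l} (s , there p , q) (s′ , there p′ , q′) =
  cong down (At-unique T (≤-trans (m≤n+m (occ k (concat T)) (occ k r)) (subst (_≤ 1) (occ-++ k r (concat T)) le)) (s , p , q) (s′ , p′ , q′))

Increasing : Tableau → Set
Increasing T = ∀ {b c y} → c ⋖ b → At T b y → ∃ λ x → At T c x × x < y

incr-↦ : ∀ r → incr r ≡ true → ∀ {j y} → r [ suc j ]↦ y → ∃ λ x → r [ j ]↦ x × x < y
incr-↦ (a ∷ b ∷ r) e (there here) = a , here , <ᵇ⇒< a b (Equivalence.from T-≡ (proj₁ (∧-true e)))
incr-↦ (a ∷ b ∷ r) e (there (there p)) =
  let x , q , lt = incr-↦ (b ∷ r) (proj₂ (∧-true {a <ᵇ b} e)) (there p) in x , there q , lt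

↦-incr : ∀ r → (∀ {j y} → r [ suc j ]↦ y → ∃ λ x → r [ j ]↦ x × x < y) → incr r ≡ true
↦-incr [] _ = refl
↦-incr (a ∷ []) _ = refl
↦-incr (a ∷ b ∷ r) h = ∧-intro first (↦-incr (b ∷ r) rest)
  where
  first : (a <ᵇ b) ≡ true
  first with h (there here)
  ... | _ , here , lt = Equivalence.to T-≡ (<⇒<ᵇ lt)
  rest : ∀ {j y} → (b ∷ r) [ suc j ]↦ y → ∃ λ x → (b ∷ r) [ j ]↦ x × x < y
  rest p with h (there p)
  ... | x , there q , lt = x , q , lt

below-↦ : ∀ r s → below r s ≡ true → ∀ {j y} → s [ j ]↦ y → ∃ λ x → r [ j ]↦ x × x < y
below-↦ (a ∷ r) (b ∷ s) e here = a , here , <ᵇ⇒< a b (Equivalence.from T-≡ (proj₁ (∧-true e)))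
below-↦ (a ∷ r) (b ∷ s) e (there p) =
  let x , q , lt = below-↦ r s (proj₂ (∧-true {a <ᵇ b} e)) p in x , there q , lt

↦-below : ∀ r s → (∀ {j y} → s [ j ]↦ y → ∃ λ x → r [ j ]↦ x × x < y) → below r s ≡ true
↦-below r [] _ = refl
↦-below [] (b ∷ s) h with h here
... | _ , () , _
↦-below (a ∷ r) (b ∷ s) h = ∧-intro first (↦-below r s rest)
  where
  first : (a <ᵇ b) ≡ true
  first with h here
  ... | _ , here , lt = Equivalence.to T-≡ (<⇒<ᵇ lt)
  rest : ∀ {j y} → s [ j ]↦ y → ∃ λ x → r [ j ]↦ x × x < y
  rest p with h (there p)
  ... | x , there q , lt = x , q , lt

cols-At : ∀ T → colsIncr T ≡ true → ∀ {i j y} → At T (suc i , j) y → ∃ λ x → At T (i , j) x × x < y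
cols-At (r ∷ s ∷ T) e (_ , there here , q) =
  let x , p , lt = below-↦ r s (proj₁ (∧-true e)) q in x , (r , here , p) , lt
cols-At (r ∷ s ∷ T) e (u , there (there p) , q) =
  let x , (v , p′ , q′) , lt = cols-At (s ∷ T) (proj₂ (∧-true {below r s} e)) (u , there p , q) in x , (v , there p′ , q′) , lt

At-cols : ∀ T → (∀ {i j y} → At T (suc i , j) y → ∃ λ x → At T (i , j) x × x < y) → colsIncr T ≡ true
At-cols [] _ = refl
At-cols (r ∷ []) _ = refl
At-cols (r ∷ s ∷ T) h = ∧-intro (↦-below r s first) (At-cols (s ∷ T) rest)
  where
  first : ∀ {j y} → s [ j ]↦ y → ∃ λ x → r [ j ]↦ x × x < y
  first q with h (s , there here , q)
  ... | x , (_ , here , p) , lt = x , p , lt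
  rest : ∀ {i j y} → At (s ∷ T) (suc i , j) y → ∃ λ x → At (s ∷ T) (i , j) x × x < y
  rest (u , p , q) with h (u , there p , q)
  ... | x , (v , there p′ , q′) , lt = x , (v , p′ , q′) , lt

-- Standard tableaux and the paths they define

record Standard (n : ℕ) (μ : List ℕ) (T : Tableau) : Set where
  field
    rows       : map length T ≡ μ
    size       : length (concat T) ≡ n
    once       : ∀ {k} → k < n → occ (suc k) (concat T) ≡ 1
    increasing : Increasing T

isSYT⇒Standard : ∀ {n μ T} → isSYT n μ T ≡ true → Standard n μ T
isSYT⇒Standard {n} {μ} {T} e with List-≡-dec _≟_ (map length T) μ
... | yes rows = record
  { rows = rows
  ; size = ≡ᵇ⇒≡ _ n (Equivalence.from T-≡ (proj₁ (∧-true entries)))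
  ; once = λ {k} k<n → ≡ᵇ⇒≡ _ 1 (Equivalence.from T-≡
      (allB-true (upTo n) (proj₂ (∧-true {length (concat T) ≡ᵇ n} entries)) (∈-upTo⁺ k<n)))
  ; increasing = increasing }
  where
  entries : entriesOK n T ≡ true
  entries = proj₁ (∧-true e)
  fill : allB incr T ∧ colsIncr T ≡ true
  fill = proj₂ (∧-true {entriesOK n T} e)
  increasing : Increasing T
  increasing (inj₁ refl) (r , p , q) =
    let x , q′ , lt = incr-↦ r (allB-true T (proj₁ (∧-true fill)) (↦-∈ p)) q in x , (r , p , q′) , lt
  increasing (inj₂ refl) at = cols-At T (proj₂ (∧-true {allB incr T} fill)) at

Standard⇒isSYT : ∀ {n μ T} → Standard n μ T → isSYT n μ T ≡ true
Standard⇒isSYT {n} {μ} {T} st with List-≡-dec _≟_ (map length T) μ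
... | no ¬rows = contradiction (Standard.rows st) ¬rows
... | yes _ = ∧-intro
    (∧-intro (Equivalence.to T-≡ (≡⇒≡ᵇ _ n size))
      (allB-intro (upTo n) λ k∈ → Equivalence.to T-≡ (≡⇒≡ᵇ _ 1 (once (∈-upTo⁻ k∈)))))
    (∧-intro (allB-intro T λ {r} r∈ → let i , p = ∈-↦ r∈ in ↦-incr r λ q → row p (increasing (inj₁ refl) (r , p , q)))
      (At-cols T (increasing (inj₂ refl))))
  where
  open Standard st
  row : ∀ {i j r y} → T [ i ]↦ r → (∃ λ x → At T (i , j) x × x < y) → ∃ λ x → r [ j ]↦ x × x < y
  row p (x , (s , p′ , q) , lt) with ↦-functional p p′
  ... | refl = x , q , lt

pos : Tableau → ℕ → Box
pos T k with any? (k ≟_) (concat T)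
... | yes k∈ = proj₁ (∈-At {T} k∈)
-- A default value; by `pos-at` the entries 1, ..., n of a standard tableau do not reach it.
... | no _   = 0 , 0

path : Tableau → ℕ → Path
path T zero    = []
path T (suc m) = pos T (suc m) ∷ path T m

path-length : ∀ T m → length (path T m) ≡ m
path-length T zero    = refl
path-length T (suc m) = cong suc (path-length T m)

∈-path⁻ : ∀ {T b} m → b ∈ path T m → ∃ λ k → k < m × b ≡ pos T (suc k)
∈-path⁻ (suc m) (here e)  = m , n<1+n m , e
∈-path⁻ (suc m) (there p) = let k , k< , e = ∈-path⁻ m p in k , m<n⇒m<1+n k< , e

∈-path⁺ : ∀ {T m k} → k < m → pos T (suc k) ∈ path T m
∈-path⁺ {T} {suc m} {k} (s≤s k≤m) with k ≟ m
... | yes refl = here refl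
... | no k≢m   = there (∈-path⁺ (≤∧≢⇒< k≤m k≢m))

rowLen-↦ : ∀ {T : Tableau} {i r} → T [ i ]↦ r → rowLen (map length T) i ≡ length r
rowLen-↦ here      = refl
rowLen-↦ (there p) = rowLen-↦ p

rowLen-row : ∀ (T : Tableau) i {j} → j < rowLen (map length T) i → ∃ λ r → T [ i ]↦ r × j < length r
rowLen-row (r ∷ T) zero    p = r , here , p
rowLen-row (r ∷ T) (suc i) p = let s , q , lt = rowLen-row T i p in s , there q , lt

module StandardPath {n μ T} (st : Standard n μ T) where
  open Standard st

  private
    ∈-entries : ∀ {k} → k < n → suc k ∈ concat T
    ∈-entries k<n = occ-∈ _ _ (once k<n)

  pos-at : ∀ {k} → k < n → At T (pos T (suc k)) (suc k)
  pos-at {k} k<n with any? (suc k ≟_) (concat T)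
  ... | yes k∈ = proj₂ (∈-At {T} k∈)
  ... | no k∉  = contradiction (∈-entries k<n) k∉

  pos-≡ : ∀ {k b} → k < n → At T b (suc k) → pos T (suc k) ≡ b
  pos-≡ k<n at = At-unique T (≤-reflexive (once k<n)) (pos-at k<n) at

  -- The n distinct values 1, …, n leave no room for other entries.
  entry-range : ∀ {b e} → At T b e → ∃ λ k → e ≡ suc k × k < n
  entry-range at with ∈-map⁻ suc (∈-resp-↭ (↭-sym all-values) (At-∈ at))
    where
    all-values : map suc (upTo n) ↭ concat T
    all-values = Unique-⊆-↭ (UniqueP.map⁺ suc-injective (UniqueP.upTo⁺ n))
      (λ v∈ → let k , k∈ , e = ∈-map⁻ suc v∈ in subst (_∈ concat T) (sym e) (∈-entries (∈-upTo⁻ k∈)))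
      (≤-reflexive (trans size (sym (trans (length-map suc (upTo n)) (length-upTo n)))))
  ... | k , k∈ , e = k , e , ∈-upTo⁻ k∈

  path-valid : ∀ m → m ≤ n → Valid (path T m)
  path-valid zero    _   = []
  path-valid (suc m) m<n = (fresh , closed) ∷ path-valid m (<⇒≤ m<n)
    where
    fresh : pos T (suc m) ∉ path T m
    fresh p = let k , k<m , e = ∈-path⁻ m p in
      <⇒≢ k<m (sym (suc-injective (At-functional (subst (λ b → At T b (suc m)) e (pos-at m<n)) (pos-at (<-trans k<m m<n)))))
    closed : ∀ {c} → c ⋖ pos T (suc m) → c ∈ path T m
    closed c⋖ with increasing c⋖ (pos-at m<n)
    ... | x , at , x< with entry-range at
    ... | k , refl , k<n = subst (_∈ path T m) (pos-≡ k<n at) (∈-path⁺ (≤-pred x<))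

  path-pt : Pt n (path T n)
  path-pt = path-valid n ≤-refl , path-length T n

  path⇒diagram : ∀ {i j} → (i , j) ∈ path T n → InDiagram μ i j
  path⇒diagram {i} {j} b∈ with ∈-path⁻ n b∈
  ... | k , k<n , e with subst (λ b → At T b (suc k)) (sym e) (pos-at k<n)
  ... | r , p , q = subst (λ ν → j < rowLen ν i) rows (subst (j <_) (sym (rowLen-↦ p)) (↦-< q))

  diagram⇒path : ∀ {i j} → InDiagram μ i j → (i , j) ∈ path T n
  diagram⇒path {i} {j} d with rowLen-row T i (subst (λ ν → j < rowLen ν i) (sym rows) d)
  ... | r , p , lt with <-↦ lt
  ... | e , q with entry-range (r , p , q)
  ... | k , refl , k<n = subst (_∈ path T n) (pos-≡ k<n (r , p , q)) (∈-path⁺ k<n)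

path-↭ : ∀ {n μ S T} → Standard n μ S → Standard n μ T → path S n ↭ path T n
path-↭ {n} {S = S} {T} ss st = Unique-⊆-↭ (Valid-unique (S.path-valid n ≤-refl))
  (λ b∈ → T.diagram⇒path (S.path⇒diagram b∈)) (≤-reflexive (trans (path-length T n) (sym (path-length S n))))
  where
  module S = StandardPath ss
  module T = StandardPath st

path-pos : ∀ {S T} m → path S m ≡ path T m → ∀ {k} → k < m → pos S (suc k) ≡ pos T (suc k)
path-pos (suc m) e {k} (s≤s k≤m) with k ≟ m
... | yes refl = ∷-injectiveˡ e
... | no k≢m   = path-pos m (∷-injectiveʳ e) (≤∧≢⇒< k≤m k≢m)

At-ext : ∀ S T → map length S ≡ map length T → (∀ {b k} → At S b k → At T b k) → S ≡ T
At-ext [] [] _ _ = refl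
At-ext (r ∷ S) (s ∷ T) e h = cong₂ _∷_ (↦-ext (∷-injectiveˡ e) (λ p → case h (r , here , p) of λ { (_ , here , q) → q }))
  (At-ext S T (∷-injectiveʳ e) (λ (u , p , q) → At-∷⁻ (h (u , there p , q))))

path-injective : ∀ {n μ S T} → Standard n μ S → Standard n μ T → path S n ≡ path T n → S ≡ T
path-injective {n} {μ} {S} {T} ss st e = At-ext S T (trans (Standard.rows ss) (sym (Standard.rows st))) transfer
  where
  transfer : ∀ {b k} → At S b k → At T b k
  transfer at with StandardPath.entry-range ss at
  ... | k , refl , k<n = subst (λ b → At T b (suc k))
        (trans (sym (path-pos n e k<n)) (StandardPath.pos-≡ ss k<n at)) (StandardPath.pos-at st k<n)

-- Exchanging two consecutive entries

data SwapVal (i : ℕ) : ℕ → ℕ → Set where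
  raise    : SwapVal i i (suc i)
  lower  : SwapVal i (suc i) i
  keep : ∀ {x} → x ≢ i → x ≢ suc i → SwapVal i x x

swapVal-view : ∀ i x → SwapVal i x (swapVal i x)
swapVal-view i x with x ≟ i
... | yes refl rewrite ≡ᵇ-refl i = raise
... | no x≢i with x ≟ suc i
... | yes refl rewrite ≡ᵇ-≢ x≢i | ≡ᵇ-refl i = lower
... | no x≢1+i rewrite ≡ᵇ-≢ x≢i | ≡ᵇ-≢ x≢1+i = keep x≢i x≢1+i

SwapVal-functional : ∀ {i x y z} → SwapVal i x y → SwapVal i x z → y ≡ z
SwapVal-functional raise raise = refl
SwapVal-functional {i} raise (keep ne _) = contradiction refl ne
SwapVal-functional lower lower = refl
SwapVal-functional lower (keep _ ne) = contradiction refl ne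
SwapVal-functional (keep ne _) raise = contradiction refl ne
SwapVal-functional (keep _ ne) lower = contradiction refl ne
SwapVal-functional (keep _ _) (keep _ _) = refl

SwapVal-sym : ∀ {i x y} → SwapVal i x y → SwapVal i y x
SwapVal-sym raise = lower
SwapVal-sym lower = raise
SwapVal-sym (keep p q) = keep p q

swapVal-≡ : ∀ {i x y} → SwapVal i x y → swapVal i x ≡ y
swapVal-≡ {i} {x} s = SwapVal-functional (swapVal-view i x) s

swapVal-involutive : ∀ i x → swapVal i (swapVal i x) ≡ x
swapVal-involutive i x = swapVal-≡ (SwapVal-sym (swapVal-view i x))

swapVal-range : ∀ {i n k} → suc i < n → k < n → ∃ λ l → swapVal (suc i) (suc k) ≡ suc l × l < n
swapVal-range {i} {n} {k} i<n k<n = go (swapVal-view (suc i) (suc k))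
  where
  go : ∀ {y} → SwapVal (suc i) (suc k) y → ∃ λ l → y ≡ suc l × l < n
  go raise          = suc i , refl , i<n
  go lower        = i , refl , <⇒≤ i<n
  go (keep _ _) = k , refl , k<n

swapVal-< : ∀ i {x y} → x < y → ¬ (x ≡ i × y ≡ suc i) → swapVal i x < swapVal i y
swapVal-< i {x} {y} x<y ¬iy = go (swapVal-view i x) (swapVal-view i y)
  where
  go : ∀ {a b} → SwapVal i x a → SwapVal i y b → a < b
  go raise raise = contradiction x<y (n≮n _)
  go raise lower = contradiction (refl , refl) ¬iy
  go raise (keep _ y≢) = ≤∧≢⇒< x<y (y≢ ∘ sym)
  go lower raise = contradiction (<-trans x<y (n<1+n i)) (n≮n _)
  go lower lower = contradiction x<y (n≮n _)
  go lower (keep _ _) = <-trans (n<1+n i) x<y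
  go (keep _ _) raise = m<n⇒m<1+n x<y
  go (keep x≢ _) lower = ≤∧≢⇒< (≤-pred x<y) x≢
  go (keep _ _) (keep _ _) = x<y

At-swapT : ∀ i {T b k} → At T b k → At (swapT i T) b (swapVal i k)
At-swapT i (r , p , q) = map (swapVal i) r , ↦-map (map (swapVal i)) p , ↦-map (swapVal i) q

At-swapT⁻ : ∀ i {T b k} → At (swapT i T) b k → ∃ λ l → At T b l × k ≡ swapVal i l
At-swapT⁻ i (r , p , q) with ↦-map⁻ (map (swapVal i)) p
... | s , p′ , refl with ↦-map⁻ (swapVal i) q
... | l , q′ , e = l , (s , p′ , q′) , e

occ-swapVal : ∀ i k xs → occ k (map (swapVal i) xs) ≡ occ (swapVal i k) xs
occ-swapVal i k [] = refl
occ-swapVal i k (x ∷ xs) with swapVal i x ≟ k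
... | yes refl rewrite ≡ᵇ-refl (swapVal i x) | swapVal-involutive i x | ≡ᵇ-refl x =
      cong suc (trans (occ-swapVal i (swapVal i x) xs) (cong (λ z → occ z xs) (swapVal-involutive i x)))
... | no ne rewrite ≡ᵇ-≢ ne | ≡ᵇ-≢ {x} {swapVal i k} (λ e → ne (trans (cong (swapVal i) e) (swapVal-involutive i k))) =
      occ-swapVal i k xs

module SwapPath {n μ T i} (st : Standard n μ T) (i<n : suc i < n) where
  open Standard st
  open StandardPath st

  Standard-swapT : ¬ Touch (pos T (suc (suc i))) (pos T (suc i)) → Standard n μ (swapT (suc i) T)
  Standard-swapT apart = record
    { rows = trans (lengths T) rows
    ; size = trans (cong length (concat-map T)) (trans (length-map (swapVal (suc i)) (concat T)) size)
    ; once = λ {k} k<n → let l , e , l<n = swapVal-range i<n k<n in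
        trans (cong (occ (suc k)) (concat-map T))
          (trans (occ-swapVal (suc i) (suc k) (concat T)) (trans (cong (λ v → occ v (concat T)) e) (once l<n)))
    ; increasing = increasing′ }
    where
    lengths : ∀ T → map length (swapT (suc i) T) ≡ map length T
    lengths []      = refl
    lengths (r ∷ T) = cong₂ _∷_ (length-map (swapVal (suc i)) r) (lengths T)
    increasing′ : Increasing (swapT (suc i) T)
    increasing′ c⋖b at with At-swapT⁻ (suc i) at
    ... | y , at-b , refl with increasing c⋖b at-b
    ... | x , at-c , x<y = swapVal (suc i) x , At-swapT (suc i) at-c , swapVal-< (suc i) x<y
          λ { (refl , refl) → apart (inj₂ (subst₂ _⋖_ (sym (pos-≡ (<⇒≤ i<n) at-c)) (sym (pos-≡ i<n at-b)) c⋖b)) }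

  touching : Touch (pos T (suc (suc i))) (pos T (suc i)) → ∀ m → suc i < m → t (suc i) (path T m) ≡ path T m
  touching touch (suc m) (s≤s i≤m) with suc i ≟ m
  ... | yes refl = trans (t-top _ (path T m) (path-length T m)) (top-touch touch)
  ... | no i≢m = trans (t-below _ (path T m) (λ e → i≢m (trans (sym e) (path-length T m))))
        (cong (pos T (suc m) ∷_) (touching touch m (≤∧≢⇒< i≤m i≢m)))

  module _ (st′ : Standard n μ (swapT (suc i) T)) where
    private
      T′ : Tableau
      T′ = swapT (suc i) T

      at-swap : ∀ {b k l} → At T b k → SwapVal (suc i) k l → At T′ b l
      at-swap at s = subst (At T′ _) (swapVal-≡ s) (At-swapT (suc i) at)

    -- Of two touching boxes the left or upper one holds the smaller entry, both before and after
    -- the exchange, which reverses the two entries.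
    apart : ¬ Touch (pos T (suc (suc i))) (pos T (suc i))
    apart (inj₁ c⋖b) with increasing c⋖b (pos-at (<⇒≤ i<n))
    ... | x , at , x< with At-functional at (pos-at i<n)
    ... | refl = n≮n _ (<-trans x< (n<1+n _))
    apart (inj₂ c⋖b) with Standard.increasing st′ c⋖b (at-swap (pos-at i<n) lower)
    ... | x , at , x< with At-functional at (at-swap (pos-at (<⇒≤ i<n)) raise)
    ... | refl = n≮n _ (<-trans x< (n<1+n _))

    private
      pos-swap : ∀ {k l} → k < n → l < n → SwapVal (suc i) (suc l) (suc k) → pos T′ (suc k) ≡ pos T (suc l)
      pos-swap k<n l<n s = StandardPath.pos-≡ st′ k<n (at-swap (pos-at l<n) s)

      path-low : ∀ m → m ≤ i → path T′ m ≡ path T m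
      path-low zero    _   = refl
      path-low (suc m) m≤i = cong₂ _∷_
        (pos-swap m<n m<n (keep (<⇒≢ (s≤s m≤i)) (<⇒≢ (m<n⇒m<1+n (s≤s m≤i)))))
        (path-low m (<⇒≤ m≤i))
        where
        m<n : m < n
        m<n = <-trans (<-trans m≤i (n<1+n i)) i<n

    apart-path : ∀ m → m ≤ n → suc i < m → path T′ m ≡ t (suc i) (path T m)
    apart-path (suc m) m<n (s≤s i≤m) with suc i ≟ m
    ... | yes refl = trans
            (cong₂ _∷_ (pos-swap i<n (<⇒≤ i<n) raise) (cong₂ _∷_ (pos-swap (<⇒≤ i<n) i<n lower) (path-low i ≤-refl)))
            (sym (trans (t-top _ (path T m) (path-length T m)) (top-apart apart)))
    ... | no i≢m = trans
            (cong₂ _∷_ (pos-swap m<n m<n (keep (λ e → <⇒≢ i≤m (sym (suc-injective e))) (i≢m ∘ sym ∘ suc-injective)))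
              (apart-path m (<⇒≤ m<n) (≤∧≢⇒< i≤m i≢m)))
            (sym (t-below _ (path T m) (λ e → i≢m (trans (sym e) (path-length T m)))))

-- Dec is a record with η, so isSYT° is convertible to isSYT but has another normal form.  In
-- bk-spec° the abstraction over isSYT leaves isSYT° alone, and the equation stored in bk,
-- at type isSYT° n μ (swapT i T) ≡ isSYT n μ (swapT i T), can be abstracted along with it.
private
  isSYT° : ℕ → List ℕ → Tableau → Bool
  isSYT° n μ T =
    ⌊ List-≡-dec (λ k l → (k ≡ᵇ l) because proof (k ≟ l)) (map length T) μ ⌋ ∧ entriesOK n T ∧ allB incr T ∧ colsIncr T

  isSYT°-≡ : ∀ n μ T → isSYT° n μ T ≡ isSYT n μ T
  isSYT°-≡ n μ T = refl

  bk-spec° : ∀ n μ i T p → (isSYT° n μ (swapT i T) ≡ true × proj₁ (bk n μ i (T , p)) ≡ swapT i T)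
    ⊎ (isSYT° n μ (swapT i T) ≡ false × proj₁ (bk n μ i (T , p)) ≡ T)
  bk-spec° n μ i T p with isSYT n μ (swapT i T) | isSYT°-≡ n μ (swapT i T)
  ... | true  | e = inj₁ (e , refl)
  ... | false | e = inj₂ (e , refl)

bk-spec : ∀ n μ i T p → (isSYT n μ (swapT i T) ≡ true × proj₁ (bk n μ i (T , p)) ≡ swapT i T)
  ⊎ (isSYT n μ (swapT i T) ≡ false × proj₁ (bk n μ i (T , p)) ≡ T)
bk-spec = bk-spec°

-- The permutation group on the tableaux of one shape

module Tableaux (n : ℕ) (μ : List ℕ) where

  SYT-≡ : ∀ {x y : SYT n μ} → proj₁ x ≡ proj₁ y → x ≡ y
  SYT-≡ {T , p} {.T , q} refl = cong (T ,_) (Decidable⇒UIP.≡-irrelevant _≟ᵇ_ p q)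

  _≟ˢ_ : DecidableEquality (SYT n μ)
  x ≟ˢ y with List-≡-dec (List-≡-dec _≟_) (proj₁ x) (proj₁ y)
  ... | yes e = yes (SYT-≡ e)
  ... | no ne = no (ne ∘ cong proj₁)

  standard : (x : SYT n μ) → Standard n μ (proj₁ x)
  standard (T , p) = isSYT⇒Standard p

  toPath : SYT n μ → Path
  toPath (T , _) = path T n

  toPath-pt : ∀ x → Pt n (toPath x)
  toPath-pt x = StandardPath.path-pt (standard x)

  toPath-injective : ∀ {x y} → toPath x ≡ toPath y → x ≡ y
  toPath-injective {x} {y} e = SYT-≡ (path-injective (standard x) (standard y) e)

  toPath-bk : ∀ i x → 1 ≤ i → i < n → toPath (bk n μ i x) ≡ t i (toPath x)
  toPath-bk (suc i) x@(T , p) _ i<n with bk-spec n μ (suc i) T p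
  ... | inj₁ (ok , e) = trans (cong (λ S → path S n) e)
          (SwapPath.apart-path (standard x) i<n (isSYT⇒Standard ok) n ≤-refl i<n)
  ... | inj₂ (bad , e) with touch? (pos T (suc (suc i))) (pos T (suc i))
  ... | yes tc = trans (cong (λ S → path S n) e) (sym (SwapPath.touching (standard x) i<n tc n i<n))
  ... | no ¬tc with trans (sym bad) (Standard⇒isSYT (SwapPath.Standard-swapT (standard x) i<n ¬tc))
  ... | ()

  toPath-eval : ∀ {w} x → Word n w → toPath (evalWord n μ w x) ≡ act w (toPath x)
  toPath-eval x [] = refl
  toPath-eval {i ∷ w} x ((p , q) ∷ ok) = trans (toPath-bk i (evalWord n μ w x) p q) (cong (t i) (toPath-eval x ok))

  bk-involutive : ∀ i x → 1 ≤ i → i < n → bk n μ i (bk n μ i x) ≡ x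
  bk-involutive i x p q = toPath-injective
    (trans (toPath-bk i (bk n μ i x) p q) (trans (cong (t i) (toPath-bk i x p q)) (t-involutive i (toPath x))))

  evalWord-++ : ∀ v w x → evalWord n μ (v ++ w) x ≡ evalWord n μ v (evalWord n μ w x)
  evalWord-++ []      w x = refl
  evalWord-++ (i ∷ v) w x = cong (bk n μ i) (evalWord-++ v w x)

  InImage-resp : ∀ {f g} → (∀ x → f x ≡ g x) → InImage n μ g → InImage n μ f
  InImage-resp e (w , ok , h) = w , ok , λ x → trans (e x) (h x)

  InImage-id : InImage n μ id
  InImage-id = [] , [] , λ _ → refl

  InImage-∘ : ∀ {f g} → InImage n μ f → InImage n μ g → InImage n μ (f ∘ g)
  InImage-∘ {f} {g} (v , vok , hv) (w , wok , hw) = v ++ w , Word-++ vok wok , λ x →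
    trans (hv (g x)) (trans (cong (evalWord n μ v) (hw x)) (sym (evalWord-++ v w x)))

  InImage-bk : ∀ {i} → 1 ≤ i → i < n → InImage n μ (bk n μ i)
  InImage-bk {i} p q = i ∷ [] , (p , q) ∷ [] , λ _ → refl

  private
    fillings : ℕ → List (List ℕ)
    fillings zero    = [] ∷ []
    fillings (suc l) = concatMap (λ k → map (k ∷_) (fillings l)) (upTo (suc n))

    tableaux : List ℕ → List Tableau
    tableaux []      = [] ∷ []
    tableaux (l ∷ ν) = concatMap (λ r → map (r ∷_) (tableaux ν)) (fillings l)

    ∈-fillings : ∀ r → All (_≤ n) r → r ∈ fillings (length r)
    ∈-fillings []      []       = here refl
    ∈-fillings (k ∷ r) (p ∷ ps) =
      ∈-concatMap⁺ (λ k → map (k ∷_) (fillings (length r))) (lose (∈-upTo⁺ (s≤s p)) (∈-map⁺ (k ∷_) (∈-fillings r ps)))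

    ∈-tableaux : ∀ T → All (All (_≤ n)) T → T ∈ tableaux (map length T)
    ∈-tableaux []      []       = here refl
    ∈-tableaux (r ∷ T) (p ∷ ps) =
      ∈-concatMap⁺ (λ r → map (r ∷_) (tableaux (map length T))) (lose (∈-fillings r p) (∈-map⁺ (r ∷_) (∈-tableaux T ps)))

    collect : List Tableau → List (SYT n μ)
    collect [] = []
    collect (T ∷ Ts) with isSYT n μ T ≟ᵇ true
    ... | yes p = (T , p) ∷ collect Ts
    ... | no _  = collect Ts

    ∈-collect : ∀ {Ts} (x : SYT n μ) → proj₁ x ∈ Ts → x ∈ collect Ts
    ∈-collect {T ∷ Ts} x x∈ with isSYT n μ T ≟ᵇ true
    ∈-collect {T ∷ Ts} x (here refl) | yes p = here (SYT-≡ refl)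
    ∈-collect {T ∷ Ts} x (there x∈)  | yes p = there (∈-collect x x∈)
    ∈-collect {T ∷ Ts} x (here refl) | no ¬p = contradiction (proj₂ x) ¬p
    ∈-collect {T ∷ Ts} x (there x∈)  | no ¬p = ∈-collect x x∈

  -- `decompose` recurses along a list that contains every point, so the finiteness of `SYT n μ` has
  -- to be given as a list.
  elements : List (SYT n μ)
  elements = collect (tableaux μ)

  ∈-elements : ∀ x → x ∈ elements
  ∈-elements x@(T , p) = ∈-collect x (subst (λ ν → T ∈ tableaux ν) (Standard.rows (standard x)) (∈-tableaux T bounded))
    where
    bounded : All (All (_≤ n)) T
    bounded = All.tabulate λ r∈ → All.tabulate λ k∈ →
      let i , p = ∈-↦ r∈ ; j , q = ∈-↦ k∈ ; l , e , l<n = StandardPath.entry-range (standard x) (_ , p , q)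
      in subst (_≤ n) (sym e) l<n

  module NonSelfTranspose (¬hook : ¬ HookShaped μ) (¬self : ¬ SelfTranspose μ) where

    swap-closed⇒⊥ : ∀ x y → (∀ {b} → b ∈ toPath x → swap b ∈ toPath y) → ⊥
    swap-closed⇒⊥ x y h = ¬self λ i j → mk⇔ turn turn
      where
      turn : ∀ {i j} → InDiagram μ i j → InDiagram μ j i
      turn d = StandardPath.path⇒diagram (standard y) (h (StandardPath.diagram⇒path (standard x) d))

    -- For a shape that is not self-transpose the classes are single tableaux, which turns cycles of
    -- classes into honest 3-cycles.
    toPath-~ : ∀ {x y} → toPath x ~ toPath y → x ≡ y
    toPath-~ (inj₁ e) = toPath-injective e
    toPath-~ {x} {y} (inj₂ e) = ⊥-elim (swap-closed⇒⊥ y x λ b∈ → subst (_ ∈_) (sym e) (∈-flip b∈))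

    11∈ : ∀ x → (1 , 1) ∈ toPath x
    11∈ x with 1 <? rowLen μ 1
    ... | yes d = StandardPath.diagram⇒path (standard x) d
    ... | no ¬d = contradiction ¬d ¬hook

    private
      -- The only shape with fewer than five boxes that contains (1 , 1) is (2,2), which is
      -- self-transpose.
      Square : ℕ → Set
      Square k = All (λ x → (1 , 1) ∈ x → All (λ b → swap b ∈ x) x) (paths k)

      square? : ∀ k → Dec (Square k)
      square? k = all? (λ x → ((1 , 1) ∈? x) →-dec all? (λ b → swap b ∈? x) x) (paths k)

      square : ∀ k → k < 5 → Square k
      square 0 _ = witness (square? 0) refl
      square 1 _ = witness (square? 1) refl
      square 2 _ = witness (square? 2) refl
      square 3 _ = witness (square? 3) refl
      square 4 _ = witness (square? 4) refl
      square (suc (suc (suc (suc (suc k))))) (s≤s (s≤s (s≤s (s≤s (s≤s ())))))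

    n≥5 : SYT n μ → 5 ≤ n
    n≥5 x with 5 ≤? n
    ... | yes p = p
    ... | no ¬p = ⊥-elim (swap-closed⇒⊥ x x
          (All.lookup (All.lookup (square n (≰⇒> ¬p)) (paths-complete n (toPath-pt x)) (11∈ x))))

    three-cycle : ∀ {a b c : SYT n μ} → a ≢ b → b ≢ c → a ≢ c →
      Σ (SYT n μ → SYT n μ) λ f → InImage n μ f × f a ≡ b × f b ≡ c × f c ≡ a
        × (∀ z → z ≢ a → z ≢ b → z ≢ c → f z ≡ z)
    three-cycle {a} {b} {c} a≢b b≢c a≢c =
        evalWord n μ word , (word , word-ok , λ _ → refl) , moves a→b , moves b→c , moves c→a
      , λ z z≢a z≢b z≢c → toPath-injective (trans (toPath-eval z word-ok)
          (fix (toPath-pt z) (z≢a ∘ toPath-~) (z≢b ∘ toPath-~) (z≢c ∘ toPath-~)))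
      where
      connected : ∀ x y → toPath x ≈[ n ] toPath y
      connected x y = full n (n≥5 y) (toPath-pt y) (11∈ y) (toPath-pt x) (path-↭ (standard x) (standard y))
      open Tri (≈⇒Tri (connected a b) (connected b c) (a≢b ∘ toPath-~) (b≢c ∘ toPath-~) (a≢c ∘ toPath-~))
      moves : ∀ {x y} → act word (toPath x) ~ toPath y → evalWord n μ word x ≡ y
      moves {x} p = toPath-~ (subst (_~ _) (sym (toPath-eval x word-ok)) p)

    open Transpositions _≟ˢ_
    open Generation (InImage n μ) InImage-resp InImage-id InImage-∘ three-cycle public using (EvenPerm⇒G)

    OddPerm : (SYT n μ → SYT n μ) → Set
    OddPerm f = Σ (List (SYT n μ → SYT n μ)) λ τs →
      All IsTransposition τs × 2 ∣ suc (length τs) × (∀ x → f x ≡ compose τs x)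

    even⊎odd : ∀ f → (∀ x y → f x ≡ f y → x ≡ y) → EvenPerm f ⊎ OddPerm f
    even⊎odd f inj with decompose elements ∈-elements f inj
    ... | τs , ts , e with parity (length τs)
    ... | inj₁ p = inj₁ (τs , ts , p , e)
    ... | inj₂ p = inj₂ (τs , ts , p , e)

    OddPerm-∘ : ∀ {f g} → OddPerm f → OddPerm g → EvenPerm (f ∘ g)
    OddPerm-∘ {f} {g} (σs , σt , σ2 , σe) (τs , τt , τ2 , τe) = σs ++ τs , AllP.++⁺ σt τt
      , subst (2 ∣_) (sym (length-++ σs))
          (∣m+n∣m⇒∣n (subst (2 ∣_) (cong suc (+-suc (length σs) (length τs))) (∣m∣n⇒∣m+n σ2 τ2)) ∣-refl)
      , λ x → trans (σe (g x)) (trans (cong (compose σs) (τe x)) (sym (compose-++ σs τs x)))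

    bk-parity : ∀ {i} → 1 ≤ i → i < n → EvenPerm (bk n μ i) ⊎ OddPerm (bk n μ i)
    bk-parity {i} p q = even⊎odd (bk n μ i) λ x y e →
      trans (sym (bk-involutive i x p q)) (trans (cong (bk n μ i) e) (bk-involutive i y p q))

    OddGenerator : Set
    OddGenerator = ∃ λ i → 1 ≤ i × i < n × OddPerm (bk n μ i)

    EvenBelow : ℕ → Set
    EvenBelow m = ∀ i → i < m → 1 ≤ i → i < n → EvenPerm (bk n μ i)

    EvenBelow-suc : ∀ {m} → EvenBelow m → (1 ≤ m → m < n → EvenPerm (bk n μ m)) → EvenBelow (suc m)
    EvenBelow-suc {m} below even i i<1+m p q = case i ≟ m of λ where
      (yes refl) → even p q
      (no i≢m)   → below i (≤∧≢⇒< (≤-pred i<1+m) i≢m) p q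

    find-odd : ∀ m → OddGenerator ⊎ EvenBelow m
    find-odd zero    = inj₂ λ _ ()
    find-odd (suc m) = case find-odd m of λ where
        (inj₁ odd)   → inj₁ odd
        (inj₂ below) → extend (1 ≤? m) (m <? n) below
      where
      extend : Dec (1 ≤ m) → Dec (m < n) → EvenBelow m → OddGenerator ⊎ EvenBelow (suc m)
      extend (no ¬p) _ below = inj₂ (EvenBelow-suc below λ p _ → contradiction p ¬p)
      extend (yes _) (no ¬q) below = inj₂ (EvenBelow-suc below λ _ q → contradiction q ¬q)
      extend (yes p) (yes q) below = case bk-parity p q of λ where
        (inj₁ even) → inj₂ (EvenBelow-suc below λ _ _ → even)
        (inj₂ odd)  → inj₁ (m , p , q , odd)

    symmetric⊎alternating :
      (∀ (f : SYT n μ → SYT n μ) → Bijective f → InImage n μ f)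
      ⊎ (∀ (f : SYT n μ → SYT n μ) → Bijective f → (InImage n μ f ⇔ EvenPerm f))
    symmetric⊎alternating with find-odd n
    ... | inj₁ (i , p , q , odd) = inj₁ λ f (inj , _) → case even⊎odd f inj of λ where
          (inj₁ even) → EvenPerm⇒G even
          -- Write `f` as the odd generator applied after its composite with `f`; that composite is
          -- even.
          (inj₂ odd′) → InImage-resp (λ x → sym (bk-involutive i (f x) p q))
            (InImage-∘ (InImage-bk p q) (EvenPerm⇒G (OddPerm-∘ odd odd′)))
    ... | inj₂ even = inj₂ λ f _ → mk⇔
          (λ (w , ok , e) → let τs , ts , 2∣ , e′ = words ok in τs , ts , 2∣ , λ x → trans (e x) (e′ x))
          EvenPerm⇒G
      where
      words : ∀ {w} → Word n w → EvenPerm (evalWord n μ w)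
      words [] = [] , [] , 2 ∣0 , λ _ → refl
      words ((p , q) ∷ ok) = EvenPerm-∘ (even _ q p q) (words ok)

theoremB : (n : ℕ) (μ : List ℕ) → IsPartition n μ → ¬ HookShaped μ → ¬ SelfTranspose μ →
    (∀ (f : SYT n μ → SYT n μ) → Bijective f → InImage n μ f)
    ⊎ (∀ (f : SYT n μ → SYT n μ) → Bijective f → (InImage n μ f ⇔ EvenPerm f))
theoremB n μ _ ¬hook ¬self = Tableaux.NonSelfTranspose.symmetric⊎alternating n μ ¬hook ¬self
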